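{- Consider an instance of the mobile facility location problem (defined in the context) and an integer $p\ge 1$. Let $S$ be any set of $k$ final locations that is a local optimum for the $p$-swap local search (i.e., no set $S'$ of $k$ locations with $|S\setminus S'|=|S'\setminus S|\le p$ has strictly smaller cost than $S$). Let $F^*$ and $C^*$ denote respectively the total movement cost and the total assignment cost of an optimal solution. Then the total cost of $S$ is at most $$\Bigl(3+O\bigl(p^{ -1/3}\bigr)\Bigr)F^*+\Bigl(5+O\bigl(p^{ -1/3}\bigr)\Bigr)C^*.$$
   Context: Mobile facility location (MFL): we are given a finite set $V$ of nodes with a metric $c$ on $V$ (nonnegative, symmetric, triangle inequality), a set $\mathcal{D}\subseteq V$ of clients where client $j$ has integer demand $d_j\ge 0$, and a set $\mathcal{F}\subseteq V$ of $k$ initial facility locations; "facility $i$" denotes the facility initially at $i\in\mathcal{F}$. A solution moves each facility $i$ to a final location $s_i\in V$, incurring movement cost $c(i,s_i)$, and assigns each client to its nearest final location, incurring assignment cost $d_j c(j,\sigma(j))$, where $\sigma(v)$ is the final location nearest to $v$. The cost of the solution is the sum of all movement costs plus all assignment costs. For a set $S$ of $k$ locations, its cost is the minimum, over perfect matchings of $\mathcal{F}$ to $S$ (facility $i$ moved to its matched location), of the total movement cost plus the resulting total assignment cost $\sum_{j}d_j c(j,\sigma(j))$. An optimal solution is one of minimum total cost; its movement cost is $F^*$ and its assignment cost is $C^*$. The $O(\cdot)$ hides absolute constants independent of the instance and of $p$.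
   Formalization: The metric c on V takes rational values instead of real values (so all movement and assignment costs are rational). -}

module Defs where

open import Data.Nat as ℕ using (ℕ; suc)
open import Data.Integer using (+_)
open import Data.Fin using (Fin; zero; suc)
open import Data.Fin.Subset using (Subset; _∈_)
open import Data.Rational using (ℚ; 0ℚ; _+_; _*_; _≤_; _/_)
open import Data.Product using (Σ; ∃; ∃-syntax; _×_)
open import Function.Definitions using (Injective)
open import Relation.Binary.PropositionalEquality using (_≡_)

ℕ→ℚ : ℕ → ℚ
ℕ→ℚ m = + m / 1

∑ : ∀ {m} → (Fin m → ℚ) → ℚ
∑ {ℕ.zero} f = 0ℚ
∑ {suc m} f = f zero + ∑ (λ i → f (suc i))

-- An instance of mobile facility location.
-- Nodes V = Fin n; clients D ⊆ V with demands d; k facilities,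
-- facility i initially at loc i (F = image of loc, a set of k nodes).
record Instance : Set where
  field
    n : ℕ
    c : Fin n → Fin n → ℚ
    c-nonneg : ∀ u v → 0ℚ ≤ c u v
    c-refl   : ∀ u → c u u ≡ 0ℚ
    c-sym    : ∀ u v → c u v ≡ c v u
    c-tri    : ∀ u v w → c u w ≤ c u v + c v w
    D   : Subset n
    d   : Fin n → ℕ
    k   : ℕ
    loc : Fin k → Fin n
    loc-inj : Injective _≡_ _≡_ loc

module _ (I : Instance) where
  open Instance I

  moveCost : (Fin k → Fin n) → ℚ
  moveCost s = ∑ (λ i → c (loc i) (s i))

  IsNearestDist : (Fin k → Fin n) → Fin n → ℚ → Set
  IsNearestDist s j δ = (∃[ i ] δ ≡ c j (s i)) × (∀ i → δ ≤ c j (s i))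

  IsAssignCost : (Fin k → Fin n) → ℚ → Set
  IsAssignCost s a =
    Σ (Fin n → ℚ) λ δ → (∀ j → IsNearestDist s j (δ j))
      × (Σ (Fin n → ℚ) λ w → (∀ j → (j ∈ D → w j ≡ ℕ→ℚ (d j) * δ j)
                                  × (¬∈ j → w j ≡ 0ℚ))
           × a ≡ ∑ w)
    where
      open import Relation.Nullary using (¬_)
      ¬∈ : Fin n → Set
      ¬∈ j = ¬ (j ∈ D)

  -- a perfect matching of facilities to the k-location set S
  -- (injective into S; with ∣ S ∣ = k this is a bijection onto S)
  IsMatching : Subset n → (Fin k → Fin n) → Set
  IsMatching S s = Injective _≡_ _≡_ s × (∀ i → s i ∈ S)

  IsCostOfSet : Subset n → ℚ → Set
  IsCostOfSet S x =
    (∃[ s ] IsMatching S s × ∃[ a ] IsAssignCost s a × x ≡ moveCost s + a)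
    × (∀ s → IsMatching S s → ∀ a → IsAssignCost s a → x ≤ moveCost s + a)

  IsOptimal : (Fin k → Fin n) → ℚ → ℚ → Set
  IsOptimal s F* C* =
    F* ≡ moveCost s × IsAssignCost s C*
    × (∀ s' a' → IsAssignCost s' a' → F* + C* ≤ moveCost s' + a')

-- Let f i, f* i be the distances from the home of facility i to its place σ i in S and to its
-- optimal place o i, let h i be the index of the place of S nearest to o i, and e i its
-- distance from o i, so that e i ≤ f i + f* i. Moving i to o i changes its movement cost by
-- f* i - f i; shifting i to σ (h i) by at most f* i - f i + e i, and this keeps a place near o i
-- open. The graph i → h i is covered by disjoint paths that start at leaves (and by isolated
-- cycles). Cut the paths wherever a vertex has several children. In each resulting window move
-- i to o i, except that i is shifted if e i is less than (f i + f* i) / m. If a window starts at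
-- a vertex with several children, its first place is refilled by shifting a whole path that
-- ends there, which costs at most 2 f* i for each i on that path: hence the coefficient
-- 3 = 1 + 2 of F*. Each place is closed at most twice, and a client of a closed place is
-- rerouted through its optimal place for 2 C*: hence the coefficient 5 = 1 + 2 · 2 of C*.
-- To open at most p places at a time, windows are cut further after some of the arcs that are
-- not shifted; the clients stranded by a cut at i go to σ i, at O(m) times their cost, and
-- averaging over the m² ≤ p phases of the cuts leaves an error of relative size O(1/m).
-- That error involves F + C itself. It is absorbed by a constant-factor bound, which comes from
-- the same windows with m = 2 and a cut after every arc that is not shifted; there the
-- stranded clients are charged to the single swaps of σ (h i) for o i.
module Submission where

open import Defs
open import Data.Nat as ℕ using (ℕ; zero; suc)
import Data.Nat.Properties as ℕ
open import Data.Nat.Induction using (<-wellFounded)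
import Data.Integer as ℤ
import Data.Integer.Properties as ℤ
open import Data.Rational using (ℚ; 0ℚ; 1ℚ; _+_; _*_; _-_; -_; _≤_; _<_; nonNegative; positive; toℚᵘ)
open import Data.Rational.Properties as ℚ using (≤-refl; ≤-trans; ≤-reflexive; ≤-total; +-mono-≤)
open import Data.Rational.Unnormalised as ℚᵘ using (mkℚᵘ)
import Data.Rational.Unnormalised.Properties as ℚᵘ
open import Data.Rational.Solver
open import Data.Bool using (Bool; true; false)
import Data.Bool.Properties as Bool
open import Data.Fin using (Fin; zero; suc; toℕ; splitAt; join; fromℕ<)
open import Data.Fin.Properties using (_≟_; any?; all?; suc-injective; injective⇒≤; splitAt-join; join-splitAt;
  fromℕ<-injective; toℕ<n; toℕ-injective)
open import Data.Fin.Subset using (Subset; _∈_; _∉_; _─_; _∩_; ∣_∣)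
open import Data.Fin.Subset.Properties using (_∈?_; ∩-comm; p─q⊆p)
open import Data.Vec using (Vec; []; _∷_; lookup; tabulate; here; there)
open import Data.Vec.Properties using (lookup∘tabulate; []=⇒lookup; lookup⇒[]=)
open import Data.List using (List; []; _∷_; allFin; cartesianProductWith)
import Data.List.Relation.Unary.Any as Any
import Data.List.Membership.Propositional as List
open import Data.List.Membership.Propositional.Properties using (∈-cartesianProductWith⁺; ∈-allFin)
open import Data.Sum using (_⊎_; inj₁; inj₂; [_,_]′)
open import Data.Sum.Properties using (inj₁-injective; inj₂-injective)
open import Data.Product using (Σ; ∃; ∃-syntax; _×_; _,_; proj₁; proj₂)
open import Function.Definitions using (Injective)
open import Induction.WellFounded using (Acc; acc)
open import Relation.Binary.Definitions using (tri<; tri≈; tri>)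
open import Relation.Binary.PropositionalEquality
open import Relation.Nullary using (¬_; Dec; yes; no; does; contradiction)
open import Relation.Nullary.Decidable using (_×-dec_; _⊎-dec_; _→-dec_; ¬?; map′; dec-true; decidable-stable;
  from-yes)
open +-*-Solver using (solve; _:+_; _:*_; _:-_; :-_; _:=_; con)

-- Ordered-field arithmetic

diff≥0 : ∀ {p q} → p ≤ q → 0ℚ ≤ q - p
diff≥0 {p} {q} p≤q = subst (_≤ q - p) (ℚ.+-inverseʳ p) (ℚ.+-monoˡ-≤ (- p) p≤q)

≤-by-diff : ∀ {p q} d → 0ℚ ≤ d → q ≡ p + d → p ≤ q
≤-by-diff {p} d 0≤d refl = subst (_≤ p + d) (ℚ.+-identityʳ p) (ℚ.+-monoʳ-≤ p 0≤d)

+≥0 : ∀ {p q} → 0ℚ ≤ p → 0ℚ ≤ q → 0ℚ ≤ p + q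
+≥0 = +-mono-≤

*≥0 : ∀ {p q} → 0ℚ ≤ p → 0ℚ ≤ q → 0ℚ ≤ p * q
*≥0 {p} {q} 0≤p 0≤q =
  subst (_≤ p * q) (ℚ.*-zeroʳ p) (ℚ.*-monoˡ-≤-nonNeg p {{nonNegative 0≤p}} 0≤q)

*-mono-≤ˡ : ∀ {r p q} → 0ℚ ≤ r → p ≤ q → r * p ≤ r * q
*-mono-≤ˡ {r} 0≤r = ℚ.*-monoˡ-≤-nonNeg r {{nonNegative 0≤r}}

*-cancel-≤ : ∀ {r p q} → 0ℚ < r → r * p ≤ r * q → p ≤ q
*-cancel-≤ {r} 0<r = ℚ.*-cancelˡ-≤-pos r {{positive 0<r}}

-- Multiplied by `e`, the conclusion is `g` times the last hypothesis plus `(e - g) * K`; for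
-- `e ≤ 0` also `g` vanishes. This later passes from a bound on demand times `e i` to one on demand
-- times `γ i`.
scale-down : ∀ {Λ g e K} → 0ℚ ≤ g → g ≤ e → 0ℚ ≤ K → Λ * e ≤ e + K → Λ * g ≤ g + K
scale-down {Λ} {g} {e} {K} 0≤g g≤e 0≤K Λe≤ with e ℚ.≤? 0ℚ
... | yes e≤0 = subst (λ z → Λ * z ≤ z + K) (ℚ.≤-antisym 0≤g (≤-trans g≤e e≤0))
  (≤-trans (≤-reflexive (ℚ.*-zeroʳ Λ)) (≤-trans 0≤K (≤-reflexive (sym (ℚ.+-identityˡ K)))))
... | no e≰0 = *-cancel-≤ (ℚ.≰⇒> e≰0) (≤-by-diff _
  (+≥0 (*≥0 0≤g (diff≥0 Λe≤)) (*≥0 (diff≥0 g≤e) 0≤K))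
  (solve 4 (λ Λ g e K → e :* (g :+ K) := e :* (Λ :* g) :+ (g :* (e :+ K :- Λ :* e) :+ (e :- g) :* K)) refl Λ g e K))

-- Finite sums

∑-cong : ∀ {m} {f g : Fin m → ℚ} → (∀ i → f i ≡ g i) → ∑ f ≡ ∑ g
∑-cong {zero} f≡g = refl
∑-cong {suc m} f≡g = cong₂ _+_ (f≡g zero) (∑-cong (λ i → f≡g (suc i)))

∑-mono : ∀ {m} {f g : Fin m → ℚ} → (∀ i → f i ≤ g i) → ∑ f ≤ ∑ g
∑-mono {zero} f≤g = ≤-refl
∑-mono {suc m} f≤g = +-mono-≤ (f≤g zero) (∑-mono (λ i → f≤g (suc i)))

∑-zero : ∀ m → ∑ {m} (λ _ → 0ℚ) ≡ 0ℚ
∑-zero zero = refl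
∑-zero (suc m) = trans (ℚ.+-identityˡ _) (∑-zero m)

∑-nonneg : ∀ {m} {f : Fin m → ℚ} → (∀ i → 0ℚ ≤ f i) → 0ℚ ≤ ∑ f
∑-nonneg {m} 0≤f = ≤-trans (≤-reflexive (sym (∑-zero m))) (∑-mono 0≤f)

∑-+ : ∀ {m} (f g : Fin m → ℚ) → ∑ (λ i → f i + g i) ≡ ∑ f + ∑ g
∑-+ {zero} f g = refl
∑-+ {suc m} f g = trans (cong (f zero + g zero +_) (∑-+ (λ i → f (suc i)) (λ i → g (suc i))))
  (solve 4 (λ a b c d → a :+ b :+ (c :+ d) := a :+ c :+ (b :+ d)) refl (f zero) (g zero) _ _)

∑-* : ∀ {m} r (f : Fin m → ℚ) → ∑ (λ i → r * f i) ≡ r * ∑ f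
∑-* {zero} r f = sym (ℚ.*-zeroʳ r)
∑-* {suc m} r f =
  trans (cong (r * f zero +_) (∑-* r (λ i → f (suc i)))) (sym (ℚ.*-distribˡ-+ r _ _))

∑-neg : ∀ {m} (f : Fin m → ℚ) → ∑ (λ i → - f i) ≡ - ∑ f
∑-neg {zero} f = refl
∑-neg {suc m} f = trans (cong (- f zero +_) (∑-neg (λ i → f (suc i)))) (sym (ℚ.neg-distrib-+ (f zero) _))

∑-- : ∀ {m} (f g : Fin m → ℚ) → ∑ (λ i → f i - g i) ≡ ∑ f - ∑ g
∑-- f g = trans (∑-+ f (λ i → - g i)) (cong (∑ f +_) (∑-neg g))

∑-swap : ∀ {m n} (f : Fin m → Fin n → ℚ) → ∑ (λ i → ∑ (f i)) ≡ ∑ (λ j → ∑ (λ i → f i j))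
∑-swap {zero} {n} f = sym (∑-zero n)
∑-swap {suc m} f = trans (cong (∑ (f zero) +_) (∑-swap (λ i → f (suc i))))
  (sym (∑-+ (f zero) (λ j → ∑ (λ i → f (suc i) j))))

ℕ→ℚ-+ : ∀ m n → ℕ→ℚ (m ℕ.+ n) ≡ ℕ→ℚ m + ℕ→ℚ n
ℕ→ℚ-+ m n = ℚ.toℚᵘ-injective (begin-equality
  toℚᵘ (ℕ→ℚ (m ℕ.+ n))                    ≃⟨ toℚᵘ-ℕ→ℚ (m ℕ.+ n) ⟩
  mkℚᵘ (ℤ.+ (m ℕ.+ n)) 0                     ≃⟨ ℚᵘ.*≡*
      (cong₂ ℤ._*_ (sym (cong₂ ℤ._+_ (ℤ.*-identityʳ (ℤ.+ m)) (ℤ.*-identityʳ (ℤ.+ n)))) refl) ⟩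
  mkℚᵘ (ℤ.+ m) 0 ℚᵘ.+ mkℚᵘ (ℤ.+ n) 0           ≃⟨ ℚᵘ.≃-sym (ℚᵘ.+-cong (toℚᵘ-ℕ→ℚ m) (toℚᵘ-ℕ→ℚ n)) ⟩
  toℚᵘ (ℕ→ℚ m) ℚᵘ.+ toℚᵘ (ℕ→ℚ n)           ≃⟨ ℚᵘ.≃-sym (ℚ.toℚᵘ-homo-+ (ℕ→ℚ m) (ℕ→ℚ n)) ⟩
  toℚᵘ (ℕ→ℚ m + ℕ→ℚ n)                     ∎)
  where
  open ℚᵘ.≤-Reasoning
  toℚᵘ-ℕ→ℚ : ∀ m → toℚᵘ (ℕ→ℚ m) ℚᵘ.≃ mkℚᵘ (ℤ.+ m) 0
  toℚᵘ-ℕ→ℚ m = ℚ.toℚᵘ-fromℚᵘ (mkℚᵘ (ℤ.+ m) 0)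

ℕ→ℚ-* : ∀ m n → ℕ→ℚ (m ℕ.* n) ≡ ℕ→ℚ m * ℕ→ℚ n
ℕ→ℚ-* zero n = sym (ℚ.*-zeroˡ (ℕ→ℚ n))
ℕ→ℚ-* (suc m) n = trans (ℕ→ℚ-+ n (m ℕ.* n)) (trans (cong (ℕ→ℚ n +_) (ℕ→ℚ-* m n))
  (trans (solve 2 (λ m n → n :+ m :* n := (con 1ℚ :+ m) :* n) refl (ℕ→ℚ m) (ℕ→ℚ n))
         (cong (_* ℕ→ℚ n) (sym (ℕ→ℚ-+ 1 m)))))

ℕ→ℚ-nonneg : ∀ m → 0ℚ ≤ ℕ→ℚ m
ℕ→ℚ-nonneg zero = ≤-refl
ℕ→ℚ-nonneg (suc m) = subst (0ℚ ≤_) (sym (ℕ→ℚ-+ 1 m)) (+≥0 (from-yes (0ℚ ℚ.≤? 1ℚ)) (ℕ→ℚ-nonneg m))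

ℕ→ℚ-mono-≤ : ∀ {m n} → m ℕ.≤ n → ℕ→ℚ m ≤ ℕ→ℚ n
ℕ→ℚ-mono-≤ {m} {n} m≤n = ≤-by-diff (ℕ→ℚ (n ℕ.∸ m)) (ℕ→ℚ-nonneg (n ℕ.∸ m))
  (trans (cong ℕ→ℚ (sym (ℕ.m+[n∸m]≡n m≤n))) (ℕ→ℚ-+ m (n ℕ.∸ m)))

∑-const : ∀ m r → ∑ {m} (λ _ → r) ≡ ℕ→ℚ m * r
∑-const zero r = sym (ℚ.*-zeroˡ r)
∑-const (suc m) r = trans (cong (r +_) (∑-const m r))
  (trans (solve 2 (λ r n → r :+ n :* r := (con 1ℚ :+ n) :* r) refl r (ℕ→ℚ m))
         (cong (_* r) (sym (ℕ→ℚ-+ 1 m))))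

-- The Iverson bracket of `P` times `v`. Charges are built from it, so that their sums over windows
-- collapse by `∑-select` and `∑-at-most-one`.
on : ∀ {P : Set} → Dec P → ℚ → ℚ
on (yes _) v = v
on (no _) v = 0ℚ

on-yes : ∀ {P : Set} (P? : Dec P) {v} → P → on P? v ≡ v
on-yes (yes _) p = refl
on-yes (no ¬p) p = contradiction p ¬p

on-no : ∀ {P : Set} (P? : Dec P) {v} → ¬ P → on P? v ≡ 0ℚ
on-no (yes p) ¬p = contradiction p ¬p
on-no (no _) ¬p = refl

on-nonneg : ∀ {P : Set} (P? : Dec P) {v} → 0ℚ ≤ v → 0ℚ ≤ on P? v
on-nonneg (yes _) 0≤v = 0≤v
on-nonneg (no _) 0≤v = ≤-refl

on-≤ : ∀ {P : Set} (P? : Dec P) {v} → 0ℚ ≤ v → on P? v ≤ v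
on-≤ (yes _) 0≤v = ≤-refl
on-≤ (no _) 0≤v = 0≤v

on-mono : ∀ {P : Set} (P? : Dec P) {u v} → (P → u ≤ v) → on P? u ≤ on P? v
on-mono (yes p) u≤v = u≤v p
on-mono (no _) u≤v = ≤-refl

∑-at-most-one : ∀ {m} {P : Fin m → Set} (P? : ∀ i → Dec (P i)) {v} → 0ℚ ≤ v →
  (∀ {i j} → P i → P j → i ≡ j) → ∑ (λ i → on (P? i) v) ≤ v
∑-at-most-one {zero} P? 0≤v uniq = 0≤v
∑-at-most-one {suc m} P? {v} 0≤v uniq with P? zero
... | no _ = ≤-trans (≤-reflexive (ℚ.+-identityˡ _))
  (∑-at-most-one (λ i → P? (suc i)) 0≤v (λ p q → suc-injective (uniq p q)))
... | yes p₀ = ≤-reflexive (trans (cong (v +_) (trans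
  (∑-cong (λ i → on-no (P? (suc i)) (λ p → contradiction (uniq p₀ p) λ ()))) (∑-zero m)))
  (ℚ.+-identityʳ v))

∑-select : ∀ {m} (a : Fin m) (f : Fin m → ℚ) → ∑ (λ i → on (a ≟ i) (f i)) ≡ f a
∑-select {suc m} zero f =
  trans (cong (f zero +_) (∑-zero m)) (ℚ.+-identityʳ _)
∑-select (suc a) f = trans (ℚ.+-identityˡ _)
  (trans (∑-cong step) (∑-select a (λ i → f (suc i))))
  where
  step : ∀ i → on (suc a ≟ suc i) (f (suc i)) ≡ on (a ≟ i) (f (suc i))
  step i with a ≟ i
  ... | yes _ = refl
  ... | no _ = refl

count : ∀ {m} {P : Fin m → Set} → (∀ i → Dec (P i)) → ℕ
count {zero} P? = 0
count {suc m} P? with P? zero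
... | yes _ = suc (count (λ i → P? (suc i)))
... | no _ = count (λ i → P? (suc i))

count-mono : ∀ {m} {P Q : Fin m → Set} (P? : ∀ i → Dec (P i)) (Q? : ∀ i → Dec (Q i)) →
  (∀ i → P i → Q i) → count P? ℕ.≤ count Q?
count-mono {zero} P? Q? P⊆Q = ℕ.z≤n
count-mono {suc m} P? Q? P⊆Q with P? zero | Q? zero
... | yes _ | yes _ = ℕ.s≤s (count-mono (λ i → P? (suc i)) (λ i → Q? (suc i)) (λ i → P⊆Q (suc i)))
... | yes p | no ¬q = contradiction (P⊆Q zero p) ¬q
... | no _  | yes _ = ℕ.m≤n⇒m≤1+n (count-mono (λ i → P? (suc i)) (λ i → Q? (suc i)) (λ i → P⊆Q (suc i)))
... | no _  | no _  = count-mono (λ i → P? (suc i)) (λ i → Q? (suc i)) (λ i → P⊆Q (suc i))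

count-mono-< : ∀ {m} {P Q : Fin m → Set} (P? : ∀ i → Dec (P i)) (Q? : ∀ i → Dec (Q i)) →
  (∀ i → P i → Q i) → ∀ y → ¬ P y → Q y → count P? ℕ.< count Q?
count-mono-< {suc m} P? Q? P⊆Q zero ¬p q with P? zero | Q? zero
... | yes p | _     = contradiction p ¬p
... | no _  | yes _ = ℕ.s≤s (count-mono (λ i → P? (suc i)) (λ i → Q? (suc i)) (λ i → P⊆Q (suc i)))
... | no _  | no ¬q = contradiction q ¬q
count-mono-< {suc m} P? Q? P⊆Q (suc y) ¬p q with P? zero | Q? zero
... | yes _ | yes _ = ℕ.s≤s (count-mono-< (λ i → P? (suc i)) (λ i → Q? (suc i)) (λ i → P⊆Q (suc i)) y ¬p q)
... | yes p | no ¬q = contradiction (P⊆Q zero p) ¬q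
... | no _  | yes _ = ℕ.m≤n⇒m≤1+n (count-mono-< (λ i → P? (suc i)) (λ i → Q? (suc i)) (λ i → P⊆Q (suc i)) y ¬p q)
... | no _  | no _  = count-mono-< (λ i → P? (suc i)) (λ i → Q? (suc i)) (λ i → P⊆Q (suc i)) y ¬p q

if′ : ∀ {P A : Set} → Dec P → A → A → A
if′ (yes _) a b = a
if′ (no _) a b = b

if-yes : ∀ {P A : Set} (P? : Dec P) {a b : A} → P → if′ P? a b ≡ a
if-yes (yes _) p = refl
if-yes (no ¬p) p = contradiction p ¬p

if-no : ∀ {P A : Set} (P? : Dec P) {a b : A} → ¬ P → if′ P? a b ≡ b
if-no (yes p) ¬p = contradiction p ¬p
if-no (no _) ¬p = refl

-- Covers of the graph of a self-map by disjoint paths.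

module _ {k : ℕ} (h : Fin k → Fin k) where

  -- A set of arcs i → h i forming vertex-disjoint directed paths: tail x is the first
  -- vertex of the path through x and pos x the position of x on it.
  record Paths : Set where
    field
      link     : Fin k → Bool
      tail     : Fin k → Fin k
      pos      : Fin k → ℕ
      tail-h   : ∀ {i} → link i ≡ true → tail (h i) ≡ tail i
      pos-h    : ∀ {i} → link i ≡ true → pos (h i) ≡ suc (pos i)
      tail-0   : ∀ {x} → pos x ≡ 0 → tail x ≡ x
      pred     : ∀ {x} → pos x ≢ 0 → ∃ λ i → link i ≡ true × h i ≡ x
      link-inj : ∀ {i i′} → link i ≡ true → link i′ ≡ true → h i ≡ h i′ → i ≡ i′

    pos-pred : ∀ {x} → pos x ≢ 0 → ∃ λ i → link i ≡ true × h i ≡ x × pos x ≡ suc (pos i) × tail x ≡ tail i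
    pos-pred px with pred px
    ... | i , l , refl = i , l , refl , pos-h l , tail-h l

    -- Both vertices arise from the same first vertex by equally many applications of `h`.
    position-unique : ∀ {x x′} → tail x ≡ tail x′ → pos x ≡ pos x′ → x ≡ x′
    position-unique t p = go _ refl (sym p) t
      where
      go : ∀ n {x x′} → pos x ≡ n → pos x′ ≡ n → tail x ≡ tail x′ → x ≡ x′
      go zero p p′ t = trans (sym (tail-0 p)) (trans t (tail-0 p′))
      go (suc n) {x} {x′} p p′ t
        with pos-pred {x} (λ p0 → ℕ.1+n≢0 (trans (sym p) p0))
           | pos-pred {x′} (λ p0 → ℕ.1+n≢0 (trans (sym p′) p0))
      ... | i , _ , refl , pi , ti | i′ , _ , refl , pi′ , ti′ =
        cong h (go n (ℕ.suc-injective (trans (sym pi) p)) (ℕ.suc-injective (trans (sym pi′) p′))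
                     (trans (sym ti) (trans t ti′)))

    -- The walk back from `x′` uses linked arcs only and passes every smaller position, hence `x`.
    linked-before : ∀ {x x′} → tail x ≡ tail x′ → pos x ℕ.< pos x′ → link x ≡ true
    linked-before t p = go _ refl t p
      where
      go : ∀ n {x x′} → pos x′ ≡ n → tail x ≡ tail x′ → pos x ℕ.< n → link x ≡ true
      go (suc n) {x} {x′} p′ t p with pos-pred {x′} (λ p0 → ℕ.1+n≢0 (trans (sym p′) p0))
      ... | i , l , refl , pi , ti with ℕ.suc-injective (trans (sym pi) p′) | trans t ti
      ...   | pi′ | t′ with pos x ℕ.≟ n
      ...     | yes px = subst (λ z → link z ≡ true) (sym (position-unique t′ (trans px (sym pi′)))) l
      ...     | no px = go n pi′ t′ (ℕ.≤∧≢⇒< (ℕ.≤-pred p) px)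

    unlinked-last : ∀ {u x} → link u ≡ false → tail x ≡ tail u → pos x ℕ.≤ pos u
    unlinked-last {u} {x} l t with pos x ℕ.≤? pos u
    ... | yes p = p
    ... | no p with trans (sym l) (linked-before (sym t) (ℕ.≰⇒> p))
    ...   | ()

    -- Each of the two is last on the common path. Thus an unlinked arc is determined by its path,
    -- which is how feeders are recognised later.
    unlinked-unique : ∀ {u u′} → link u ≡ false → link u′ ≡ false → tail u ≡ tail u′ → u ≡ u′
    unlinked-unique l l′ t =
      position-unique t (ℕ.≤-antisym (unlinked-last l′ t) (unlinked-last l (sym t)))

    pos-tail : ∀ x → pos (tail x) ≡ 0
    pos-tail x = go _ refl
      where
      go : ∀ n {x} → pos x ≡ n → pos (tail x) ≡ 0
      go zero p = trans (cong pos (tail-0 p)) p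
      go (suc n) {x} p with pos-pred {x} (λ p0 → ℕ.1+n≢0 (trans (sym p) p0))
      ... | i , _ , refl , pi , ti = trans (cong pos ti) (go n (ℕ.suc-injective (trans (sym pi) p)))

  no-arcs : Paths
  no-arcs = record
    { link = λ _ → false ; tail = λ x → x ; pos = λ _ → 0
    ; tail-h = λ () ; pos-h = λ () ; tail-0 = λ _ → refl
    ; pred = λ p → contradiction refl p ; link-inj = λ () }

  true≢false : ∀ {b : Bool} → b ≡ true → b ≢ false
  true≢false refl ()

  -- Appends the path that starts at `h i` to the path that ends at `i`; the positions on the former
  -- move up by the length of the latter.
  module Merge (L : Paths) {i : Fin k} (¬l : Paths.link L i ≡ false)
               (pos-hi : Paths.pos L (h i) ≡ 0) (tail-i : Paths.tail L i ≢ h i) where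

    open Paths L

    link′ : Fin k → Bool
    link′ j = if′ (j ≟ i) true (link j)

    tail′ : Fin k → Fin k
    tail′ x = if′ (tail x ≟ h i) (tail i) (tail x)

    pos′ : Fin k → ℕ
    pos′ x = if′ (tail x ≟ h i) (pos x ℕ.+ suc (pos i)) (pos x)

    link′-elim : ∀ {j} → link′ j ≡ true → j ≡ i ⊎ link j ≡ true
    link′-elim {j} l with j ≟ i
    ... | yes p = inj₁ p
    ... | no _ = inj₂ l

    link′-old : ∀ {j} → link j ≡ true → link′ j ≡ true
    link′-old {j} l with j ≟ i
    ... | yes _ = refl
    ... | no _ = l

    pos≢0⇒pos′≢0 : ∀ {x} → pos x ≢ 0 → pos′ x ≢ 0
    pos≢0⇒pos′≢0 {x} px p′ with tail x ≟ h i
    ... | yes _ = px (ℕ.m+n≡0⇒m≡0 (pos x) p′)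
    ... | no _ = px p′

    pos′-hi : pos′ (h i) ≢ 0
    pos′-hi p with tail (h i) ≟ h i
    ... | yes _ = ℕ.1+n≢0 (ℕ.m+n≡0⇒n≡0 (pos (h i)) p)
    ... | no q = q (tail-0 pos-hi)

    tail-h′ : ∀ {j} → link′ j ≡ true → tail′ (h j) ≡ tail′ j
    tail-h′ {j} l with link′-elim {j} l
    ... | inj₁ refl = trans (if-yes (tail (h i) ≟ h i) (tail-0 pos-hi)) (sym (if-no (tail i ≟ h i) tail-i))
    ... | inj₂ l₀ = cong (λ t → if′ (t ≟ h i) (tail i) t) (tail-h l₀)

    pos-h′ : ∀ {j} → link′ j ≡ true → pos′ (h j) ≡ suc (pos′ j)
    pos-h′ {j} l with link′-elim {j} l
    ... | inj₁ refl = trans (if-yes (tail (h i) ≟ h i) (tail-0 pos-hi))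
      (trans (cong (ℕ._+ suc (pos i)) pos-hi) (cong suc (sym (if-no (tail i ≟ h i) tail-i))))
    ... | inj₂ l₀ with tail j ≟ h i
    ...   | yes t = trans (if-yes (tail (h j) ≟ h i) (trans (tail-h l₀) t)) (cong (ℕ._+ suc (pos i)) (pos-h l₀))
    ...   | no t = trans (if-no (tail (h j) ≟ h i) (λ q → t (trans (sym (tail-h l₀)) q))) (pos-h l₀)

    tail-0′ : ∀ {x} → pos′ x ≡ 0 → tail′ x ≡ x
    tail-0′ {x} p with tail x ≟ h i
    ... | yes _ = contradiction (ℕ.m+n≡0⇒n≡0 (pos x) p) ℕ.1+n≢0
    ... | no _ = tail-0 p

    pred′ : ∀ {x} → pos′ x ≢ 0 → ∃ λ j → link′ j ≡ true × h j ≡ x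
    pred′ {x} p with pos x ℕ.≟ 0
    ... | no px with pred px
    ...   | j , l , hj = j , link′-old l , hj
    pred′ {x} p | yes px with tail x ≟ h i
    ...   | yes t = i , if-yes (i ≟ i) refl , trans (sym t) (tail-0 px)
    ...   | no _ = contradiction px p

    link-inj′ : ∀ {j j′} → link′ j ≡ true → link′ j′ ≡ true → h j ≡ h j′ → j ≡ j′
    link-inj′ {j} {j′} l l′ e with link′-elim {j} l | link′-elim {j′} l′
    ... | inj₁ refl | inj₁ refl = refl
    ... | inj₁ refl | inj₂ l₀ = contradiction (trans (sym (pos-h l₀)) (trans (cong pos (sym e)) pos-hi)) ℕ.1+n≢0
    ... | inj₂ l₀ | inj₁ refl = contradiction (trans (sym (pos-h l₀)) (trans (cong pos e) pos-hi)) ℕ.1+n≢0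
    ... | inj₂ l₀ | inj₂ l₁ = link-inj l₀ l₁ e

    merged : Paths
    merged = record
      { link = link′ ; tail = tail′ ; pos = pos′ ; tail-h = tail-h′ ; pos-h = pos-h′
      ; tail-0 = tail-0′ ; pred = pred′ ; link-inj = link-inj′ }

  -- A path closed up to a cycle by its unlinked last arc u → h u is reopened at v.
  module Rotate (L : Paths) {u v : Fin k} (¬l : Paths.link L u ≡ false)
                (pos-hu : Paths.pos L (h u) ≡ 0) (tail-u : Paths.tail L u ≡ h u)
                (pos-v : Paths.pos L v ≢ 0) (tail-v : Paths.tail L v ≡ h u) where

    open Paths L

    c : Fin k
    c = proj₁ (pred pos-v)

    link-c : link c ≡ true
    link-c = proj₁ (proj₂ (pred pos-v))

    h-c : h c ≡ v
    h-c = proj₂ (proj₂ (pred pos-v))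

    pv≤pu : pos v ℕ.≤ pos u
    pv≤pu = unlinked-last ¬l (trans tail-v (sym tail-u))

    link′ : Fin k → Bool
    link′ j = if′ (j ≟ u) true (if′ (j ≟ c) false (link j))

    -- Positions are rotated modulo the length `suc (pos u)` of the cycle: those from `v` on start
    -- at 0, those before `v` continue after `u`.
    shift : ℕ → ℕ
    shift p = if′ (pos v ℕ.≤? p) (p ℕ.∸ pos v) (p ℕ.+ (suc (pos u) ℕ.∸ pos v))

    tail′ : Fin k → Fin k
    tail′ x = if′ (tail x ≟ h u) v (tail x)

    pos′ : Fin k → ℕ
    pos′ x = if′ (tail x ≟ h u) (shift (pos x)) (pos x)

    link′-elim : ∀ {j} → link′ j ≡ true → j ≡ u ⊎ j ≢ c × link j ≡ true
    link′-elim {j} l with j ≟ u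
    ... | yes p = inj₁ p
    ... | no _ with j ≟ c
    ...   | no q = inj₂ (q , l)

    link′-old : ∀ {j} → j ≢ c → link j ≡ true → link′ j ≡ true
    link′-old {j} q l with j ≟ u
    ... | yes _ = refl
    ... | no _ = trans (if-no (j ≟ c) q) l

    link′-none : ∀ {j} → j ≢ u → link j ≡ false → link′ j ≡ false
    link′-none {j} p l = trans (if-no (j ≟ u) p)
      (trans (if-no (j ≟ c) (λ { refl → true≢false link-c l })) l)

    tail-hu : tail (h u) ≡ h u
    tail-hu = tail-0 pos-hu

    shift-hu : shift 0 ≡ suc (pos u) ℕ.∸ pos v
    shift-hu = if-no (pos v ℕ.≤? 0) (λ q → pos-v (ℕ.n≤0⇒n≡0 q))

    shift-suc : ∀ {p} → pos v ≢ suc p → shift (suc p) ≡ suc (shift p)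
    shift-suc {p} q with pos v ℕ.≤? p
    ... | yes r = trans (if-yes (pos v ℕ.≤? suc p) (ℕ.m≤n⇒m≤1+n r)) (ℕ.+-∸-assoc 1 r)
    ... | no r = if-no (pos v ℕ.≤? suc p) (λ s → q (ℕ.≤-antisym s (ℕ.≰⇒> r)))

    shift-0 : ∀ {p} → shift p ≡ 0 → p ≡ pos v
    shift-0 {p} s with pos v ℕ.≤? p
    ... | yes r = ℕ.≤-antisym (ℕ.m∸n≡0⇒m≤n s) r
    ... | no r = contradiction (ℕ.m∸n≡0⇒m≤n {suc (pos u)} (ℕ.m+n≡0⇒n≡0 p s))
        (λ t → ℕ.<-irrefl refl (ℕ.≤-trans t pv≤pu))

    pos′-v : pos′ v ≡ 0
    pos′-v = trans (if-yes (tail v ≟ h u) tail-v)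
      (trans (if-yes (pos v ℕ.≤? pos v) ℕ.≤-refl) (ℕ.n∸n≡0 (pos v)))

    pos′-0 : ∀ {x} → pos′ x ≡ 0 → x ≡ v ⊎ pos x ≡ 0 × x ≢ h u
    pos′-0 {x} p with tail x ≟ h u
    ... | yes t = inj₁ (position-unique (trans t (sym tail-v)) (shift-0 p))
    ... | no t = inj₂ (p , λ { refl → t tail-hu })

    tail-h′ : ∀ {j} → link′ j ≡ true → tail′ (h j) ≡ tail′ j
    tail-h′ {j} l with link′-elim {j} l
    ... | inj₁ refl = cong (λ t → if′ (t ≟ h u) v t) (trans tail-hu (sym tail-u))
    ... | inj₂ (_ , l₀) = cong (λ t → if′ (t ≟ h u) v t) (tail-h l₀)

    pos-h′ : ∀ {j} → link′ j ≡ true → pos′ (h j) ≡ suc (pos′ j)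
    pos-h′ {j} l with link′-elim {j} l
    ... | inj₁ refl = trans (if-yes (tail (h u) ≟ h u) tail-hu)
      (trans (trans (cong shift pos-hu) (trans shift-hu (ℕ.+-∸-assoc 1 pv≤pu)))
        (cong suc (sym (trans (if-yes (tail u ≟ h u) tail-u) (if-yes (pos v ℕ.≤? pos u) pv≤pu)))))
    ... | inj₂ (q , l₀) with tail j ≟ h u
    ...   | no t = trans (if-no (tail (h j) ≟ h u) (λ r → t (trans (sym (tail-h l₀)) r))) (pos-h l₀)
    ...   | yes t = trans (if-yes (tail (h j) ≟ h u) (trans (tail-h l₀) t))
      (trans (cong shift (pos-h l₀)) (shift-suc (λ r → q (link-inj l₀ link-c (trans
        (position-unique (trans (tail-h l₀) (trans t (sym tail-v))) (trans (pos-h l₀) (sym r))) (sym h-c))))))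

    tail-0′ : ∀ {x} → pos′ x ≡ 0 → tail′ x ≡ x
    tail-0′ {x} p with tail x ≟ h u
    ... | yes t = sym (position-unique (trans t (sym tail-v)) (shift-0 p))
    ... | no _ = tail-0 p

    pred′ : ∀ {x} → pos′ x ≢ 0 → ∃ λ j → link′ j ≡ true × h j ≡ x
    pred′ {x} p with pos x ℕ.≟ 0
    ... | no px with pred px
    ...   | j , l , refl = j , link′-old (λ { refl → p (trans (cong pos′ h-c) pos′-v) }) l , refl
    pred′ {x} p | yes px with tail x ≟ h u
    ...   | yes t = u , if-yes (u ≟ u) refl , trans (sym t) (tail-0 px)
    ...   | no _ = contradiction px p

    link-inj′ : ∀ {j j′} → link′ j ≡ true → link′ j′ ≡ true → h j ≡ h j′ → j ≡ j′
    link-inj′ {j} {j′} l l′ e with link′-elim {j} l | link′-elim {j′} l′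
    ... | inj₁ refl | inj₁ refl = refl
    ... | inj₁ refl | inj₂ (_ , l₀) = contradiction (trans (sym (pos-h l₀)) (trans (cong pos (sym e)) pos-hu)) ℕ.1+n≢0
    ... | inj₂ (_ , l₀) | inj₁ refl = contradiction (trans (sym (pos-h l₀)) (trans (cong pos e) pos-hu)) ℕ.1+n≢0
    ... | inj₂ (_ , l₀) | inj₂ (_ , l₁) = link-inj l₀ l₁ e

    rotated : Paths
    rotated = record
      { link = link′ ; tail = tail′ ; pos = pos′ ; tail-h = tail-h′ ; pos-h = pos-h′
      ; tail-0 = tail-0′ ; pred = pred′ ; link-inj = link-inj′ }

  -- The first vertex of a path receives an arc only if that arc closes the path up to a
  -- connected component of the graph which is a mere cycle.
  Saturated : Paths → Set
  Saturated L = ∀ {i} → link i ≡ false → pos (h i) ≡ 0 →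
    tail i ≡ h i × (∀ {i′} → link i′ ≡ false → tail (h i′) ≡ h i → i′ ≡ i)
    where open Paths L

  abstract
    -- Every violation of saturation allows a change that decreases the number of first vertices,
    -- that is, of paths. If an unlinked arc enters the first vertex of another path, the two paths
    -- are merged.
    saturate : Σ Paths Saturated
    saturate = go no-arcs (<-wellFounded _)
      where
      open Paths
      tails : Paths → ℕ
      tails L = count (λ x → pos L x ℕ.≟ 0)
      go : (L : Paths) → Acc ℕ._<_ (tails L) → Σ Paths Saturated
      go L (acc rec) with any? (λ i → link L i Bool.≟ false ×-dec pos L (h i) ℕ.≟ 0 ×-dec ¬? (tail L i ≟ h i))
      ... | yes (i , l , p , t) = go merged (rec (count-mono-< (λ x → pos′ x ℕ.≟ 0) (λ x → pos L x ℕ.≟ 0)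
              (λ x q → decidable-stable (pos L x ℕ.≟ 0) (λ px → pos≢0⇒pos′≢0 px q)) (h i) pos′-hi p))
        where open Merge L l p t
      ... | no none with any? (λ u → any? (λ i → link L u Bool.≟ false ×-dec pos L (h u) ℕ.≟ 0 ×-dec
                           link L i Bool.≟ false ×-dec tail L (h i) ≟ h u ×-dec ¬? (i ≟ u)))
      ...   | no pure = L , λ {i} l p →
              decidable-stable (tail L i ≟ h i) (λ t → none (i , l , p , t)) ,
              λ {i′} l′ t → decidable-stable (i′ ≟ i) (λ i′≢i → pure (i , i′ , l , p , l′ , t , i′≢i))
      -- The path of `u` closes up to a cycle which the arc of `i` enters elsewhere, at `h i`.
      -- Reopened there, it is appended to the path of `i`: `h u` ceases to be a first vertex and
      -- `h i` does not become one.
      ...   | yes (u , i , lu , pu , li , ti , i≢u) = go M.merged (rec (count-mono-<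
              (λ x → M.pos′ x ℕ.≟ 0) (λ x → pos L x ℕ.≟ 0) zeros (h u) (λ q → hu (zeros′ q)) pu))
        where
        tu : tail L u ≡ h u
        tu = decidable-stable (tail L u ≟ h u) (λ t → none (u , lu , pu , t))
        tail-i≢hu : tail L i ≢ h u
        tail-i≢hu t = i≢u (unlinked-unique L li lu (trans t (sym tu)))
        pv : pos L (h i) ≢ 0
        pv p = tail-i≢hu (trans (decidable-stable (tail L i ≟ h i) (λ t → none (i , li , p , t)))
                                (trans (sym (tail-0 L p)) ti))
        module R = Rotate L lu pu tu pv ti
        module M = Merge R.rotated {i} (R.link′-none i≢u li) R.pos′-v
          (λ t → pv (subst (λ z → pos L z ≡ 0) (trans (sym (if-no (tail L i ≟ h u) tail-i≢hu)) t) (pos-tail L i)))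
        zeros′ : ∀ {x} → M.pos′ x ≡ 0 → pos L x ≡ 0 × x ≢ h u
        zeros′ {x} q with R.pos′-0 {x} (decidable-stable (R.pos′ x ℕ.≟ 0) (λ px → M.pos≢0⇒pos′≢0 px q))
        ... | inj₁ refl = contradiction q M.pos′-hi
        ... | inj₂ r = r
        zeros : ∀ x → M.pos′ x ≡ 0 → pos L x ≡ 0
        zeros x q = proj₁ (zeros′ q)
        hu : ¬ (pos L (h u) ≡ 0 × h u ≢ h u)
        hu (_ , q) = q refl

-- Segments, windows and the rearrangement belonging to a window.

module Segments {k : ℕ} (h : Fin k → Fin k) (L : Paths h) (saturated : Saturated h L)
                (good : Fin k → Bool) where

  open Paths L

  Special : Fin k → Set
  Special x = ∃ λ i → link i ≡ false × h i ≡ x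

  special? : ∀ x → Dec (Special x)
  special? x = any? (λ i → link i Bool.≟ false ×-dec h i ≟ x)

  feeder : Fin k → Fin k
  feeder x with special? x
  ... | yes (i , _) = i
  ... | no _ = x

  feeder-spec : ∀ {x} → Special x → link (feeder x) ≡ false × h (feeder x) ≡ x
  feeder-spec {x} sp with special? x
  ... | yes (_ , s) = s
  ... | no ¬sp = contradiction sp ¬sp

  Internal : Fin k → Set
  Internal i = link i ≡ true × ¬ Special (h i)

  internal? : ∀ i → Dec (Internal i)
  internal? i = link i Bool.≟ true ×-dec ¬? (special? (h i))

  -- A second arc into `h i` would be linked, against `link-inj`, or would make `h i` special. Hence
  -- closing the place of `h i` leaves only the clients of `o i` without a nearby place.
  only-child : ∀ {i} → Internal i → ∀ {i′} → h i′ ≡ h i → i′ ≡ i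
  only-child {i} (l , ¬sp) {i′} e with link i′ in l′
  ... | true = link-inj l′ l e
  ... | false = contradiction (i′ , l′ , e) ¬sp

  -- Facility i is shifted to the place of h i if H i, and moved to its optimal place otherwise.
  H : Fin k → Set
  H i = Internal i × good i ≡ false

  H? : ∀ i → Dec (H i)
  H? i = internal? i ×-dec good i Bool.≟ false

  view : ∀ x → (Special x ⊎ pos x ≡ 0) ⊎ ∃ λ i → Internal i × h i ≡ x
  view x with special? x
  ... | yes sp = inj₁ (inj₁ sp)
  ... | no ¬sp with pos x ℕ.≟ 0
  ...   | yes p = inj₁ (inj₂ p)
  ...   | no p with pred p
  ...     | i , l , refl = inj₂ (i , (l , ¬sp) , refl)

  -- Segments are not represented as objects; statements about them are proved by this induction on
  -- the position.
  path-induction : (P : Fin k → Set) → (∀ {x} → Special x ⊎ pos x ≡ 0 → P x) →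
    (∀ {i} → Internal i → P i → P (h i)) → ∀ x → P x
  path-induction P base step x = go (pos x) refl
    where
    go : ∀ n {x} → pos x ≡ n → P x
    go n {x} p with view x
    ... | inj₁ b = base b
    go zero p | inj₂ (i , (l , _) , refl) = contradiction (trans (sym (pos-h l)) p) ℕ.1+n≢0
    go (suc n) p | inj₂ (i , int , refl) =
      step int (go n (ℕ.suc-injective (trans (sym (pos-h (proj₁ int))) p)))

  -- In phase φ, every segment between special vertices is cut after the good arcs
  -- of colour ℓ′, so that a window (the vertices with the same first) contains at most one good arc of each colour 0 … ℓ′.
  module Windows (ℓ′ φ : ℕ) where

    private
      State : Set
      State = Fin k × ℕ

      step : Fin k → State → State
      step i (f , c) = if′ (good i Bool.≟ true) (if′ (c ℕ.≟ ℓ′) (h i , 0) (f , suc c)) (f , c)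

      -- The state is the first vertex of the current window with the current colour. The number is
      -- fuel, and it equals the position, so each linked arc consumes one unit. Only the first
      -- window of a segment starts with colour `φ`, the later ones with 0; this is how the phase
      -- displaces the cuts.
      run : ℕ → Fin k → State
      next : ℕ → ∀ x → Dec (pos x ≡ 0) → State

      run zero x = x , φ
      run (suc n) x = if′ (special? x) (x , φ) (next n x (pos x ℕ.≟ 0))
      next n x (yes _) = x , φ
      next n x (no p) = step (proj₁ (pred p)) (run n (proj₁ (pred p)))

      state : Fin k → State
      state x = run (pos x) x

      state-first : ∀ {x} → Special x ⊎ pos x ≡ 0 → state x ≡ (x , φ)
      state-first {x} b with pos x in p
      ... | zero = refl
      ... | suc n with special? x
      ...   | yes _ = refl
      ...   | no ¬sp = contradiction b [ ¬sp , (λ ()) ]′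

      state-h : ∀ {i} → Internal i → state (h i) ≡ step i (state i)
      state-h {i} int@(l , ¬sp) = trans (cong (λ n → run n (h i)) (pos-h l))
        (trans (if-no (special? (h i)) ¬sp) (go (pos (h i) ℕ.≟ 0)))
        where
        go : ∀ d → next (pos i) (h i) d ≡ step i (state i)
        go (yes p) = contradiction (trans (sym (pos-h l)) p) ℕ.1+n≢0
        go (no p) = cong (λ j → step j (run (pos i) j)) (only-child int (proj₂ (proj₂ (pred p))))

    first : Fin k → Fin k
    first x = proj₁ (state x)

    colour : Fin k → ℕ
    colour x = proj₂ (state x)

    Cut : Fin k → Set
    Cut i = Internal i × good i ≡ true × colour i ≡ ℓ′

    cut? : ∀ i → Dec (Cut i)
    cut? i = internal? i ×-dec good i Bool.≟ true ×-dec colour i ℕ.≟ ℓ′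

    first-base : ∀ {x} → Special x ⊎ pos x ≡ 0 → first x ≡ x
    first-base b = cong proj₁ (state-first b)

    colour-base : ∀ {x} → Special x ⊎ pos x ≡ 0 → colour x ≡ φ
    colour-base b = cong proj₂ (state-first b)

    module _ {i} (int : Internal i) where

      state-shift : good i ≡ false → state (h i) ≡ state i
      state-shift g = trans (state-h int) (if-no (good i Bool.≟ true) (λ g′ → true≢false h g′ g))

      state-take : good i ≡ true → colour i ≢ ℓ′ → state (h i) ≡ (first i , suc (colour i))
      state-take g c = trans (state-h int) (trans (if-yes (good i Bool.≟ true) g) (if-no (colour i ℕ.≟ ℓ′) c))

      state-cut : good i ≡ true → colour i ≡ ℓ′ → state (h i) ≡ (h i , 0)
      state-cut g c = trans (state-h int) (trans (if-yes (good i Bool.≟ true) g) (if-yes (colour i ℕ.≟ ℓ′) c))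

      data Step : Set where
        shifted : H i → first (h i) ≡ first i → colour (h i) ≡ colour i → Step
        taken   : good i ≡ true → colour i ≢ ℓ′ → first (h i) ≡ first i → colour (h i) ≡ suc (colour i) → Step
        cut     : Cut i → first (h i) ≡ h i → colour (h i) ≡ 0 → Step

      step-view : Step
      step-view with good i in g | colour i ℕ.≟ ℓ′
      ... | false | _ = shifted (int , g) (cong proj₁ (state-shift g)) (cong proj₂ (state-shift g))
      ... | true | no c = taken g c (cong proj₁ (state-take g c)) (cong proj₂ (state-take g c))
      ... | true | yes c = cut (int , g , c) (cong proj₁ (state-cut g c)) (cong proj₂ (state-cut g c))

    good⇒¬H : ∀ {i} → good i ≡ true → ¬ H i
    good⇒¬H g (_ , b) = true≢false h g b

    first-tail : ∀ x → tail (first x) ≡ tail x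
    first-tail = path-induction _ (λ b → cong tail (first-base b)) ind
      where
      ind : ∀ {i} → Internal i → tail (first i) ≡ tail i → tail (first (h i)) ≡ tail (h i)
      ind int t with step-view int
      ... | shifted _ f _ = trans (cong tail f) (trans t (sym (tail-h (proj₁ int))))
      ... | taken _ _ f _ = trans (cong tail f) (trans t (sym (tail-h (proj₁ int))))
      ... | cut _ f _ = cong tail f

    first-pos : ∀ x → pos (first x) ℕ.≤ pos x
    first-pos = path-induction _ (λ b → ℕ.≤-reflexive (cong pos (first-base b))) ind
      where
      ind : ∀ {i} → Internal i → pos (first i) ℕ.≤ pos i → pos (first (h i)) ℕ.≤ pos (h i)
      ind {i} int p with step-view int
      ... | shifted _ f _ = subst₂ ℕ._≤_ (cong pos (sym f)) (sym (pos-h (proj₁ int))) (ℕ.m≤n⇒m≤1+n p)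
      ... | taken _ _ f _ = subst₂ ℕ._≤_ (cong pos (sym f)) (sym (pos-h (proj₁ int))) (ℕ.m≤n⇒m≤1+n p)
      ... | cut _ f _ = ℕ.≤-reflexive (cong pos f)

    colour-≤ : φ ℕ.≤ ℓ′ → ∀ x → colour x ℕ.≤ ℓ′
    colour-≤ φ≤ = path-induction _ (λ b → subst (ℕ._≤ ℓ′) (sym (colour-base b)) φ≤) ind
      where
      ind : ∀ {i} → Internal i → colour i ℕ.≤ ℓ′ → colour (h i) ℕ.≤ ℓ′
      ind int p with step-view int
      ... | shifted _ _ c = subst (ℕ._≤ ℓ′) (sym c) p
      ... | taken _ q _ c = subst (ℕ._≤ ℓ′) (sym c) (ℕ.≤∧≢⇒< p q)
      ... | cut _ _ c = subst (ℕ._≤ ℓ′) (sym c) ℕ.z≤n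

    before-first : ∀ {i x} → pos i ℕ.< pos x → first i ≢ x
    before-first {i} p refl = ℕ.<⇒≱ p (first-pos i)

    private
      -- The arc leaving `i` inside the window is good, so it raises the colour; afterwards only a
      -- cut could lower it, and a cut opens a new window.
      colour-increases : ∀ {i} → ¬ H i → ∀ x → tail x ≡ tail i → pos i ℕ.< pos x → first x ≡ first i →
        colour i ℕ.< colour x
      colour-increases {i} ¬H-i = path-induction _
        (λ b _ p f → contradiction (trans (sym f) (first-base b)) (before-first p)) ind
        where
        ind : ∀ {q} → Internal q →
          (tail q ≡ tail i → pos i ℕ.< pos q → first q ≡ first i → colour i ℕ.< colour q) →
          tail (h q) ≡ tail i → pos i ℕ.< pos (h q) → first (h q) ≡ first i → colour i ℕ.< colour (h q)
        ind {q} int ih t p f with step-view int | pos i ℕ.≟ pos q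
        ... | cut _ f′ _ | _ = contradiction (trans (sym f) f′) (before-first p)
        ... | shifted H-q f′ c | yes e = contradiction
              (subst H (position-unique (trans (sym (tail-h (proj₁ int))) t) (sym e)) H-q) ¬H-i
        ... | shifted _ f′ c | no e = subst (colour i ℕ.<_) (sym c) (ih (trans (sym (tail-h (proj₁ int))) t)
              (ℕ.≤∧≢⇒< (ℕ.≤-pred (subst (pos i ℕ.<_) (pos-h (proj₁ int)) p)) e) (trans (sym f′) f))
        ... | taken _ _ f′ c | yes e = subst (colour i ℕ.<_) (sym c) (ℕ.s≤s (ℕ.≤-reflexive (cong colour
              (position-unique (trans (sym t) (tail-h (proj₁ int))) e))))
        ... | taken _ _ f′ c | no e = subst (colour i ℕ.<_) (sym c)
            (ℕ.m≤n⇒m≤1+n (ih (trans (sym (tail-h (proj₁ int))) t)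
              (ℕ.≤∧≢⇒< (ℕ.≤-pred (subst (pos i ℕ.<_) (pos-h (proj₁ int)) p)) e) (trans (sym f′) f)))

    -- This limits the facilities moved in one window to the number of colours. The last vertex of a
    -- segment is included: its arc is not internal, so it is not in `H`.
    colour-injective : ∀ {i i′} → ¬ H i → ¬ H i′ → first i ≡ first i′ → colour i ≡ colour i′ → i ≡ i′
    colour-injective {i} {i′} ¬H-i ¬H-i′ f c with trans (sym (first-tail i)) (trans (cong tail f) (first-tail i′))
    ... | t with ℕ.<-cmp (pos i) (pos i′)
    ...   | tri≈ _ p _ = position-unique t p
    ...   | tri< p _ _ = contradiction (colour-increases ¬H-i i′ (sym t) p (sym f)) (ℕ.<-irrefl c)
    ...   | tri> _ _ p = contradiction (colour-increases ¬H-i′ i t p f) (ℕ.<-irrefl (sym c))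

    -- Facilities shifted in order to refill the special first vertex y of a window.
    Fill : Fin k → Fin k → Set
    Fill y i = Special y × tail i ≡ tail (feeder y) × first i ≢ y
             × (tail i ≡ tail y → pos y ℕ.≤ pos i → pos y ≡ 0)

    fill? : ∀ y i → Dec (Fill y i)
    fill? y i = special? y ×-dec tail i ≟ tail (feeder y) ×-dec ¬? (first i ≟ y)
      ×-dec (tail i ≟ tail y →-dec (pos y ℕ.≤? pos i →-dec pos y ℕ.≟ 0))

    -- The path of `i` has only one unlinked arc, and that arc must lead to `y`. So each facility
    -- takes part in at most one refill, and pays for it once.
    fill-unique : ∀ {y y′ i} → Fill y i → Fill y′ i → y ≡ y′
    fill-unique {y} {y′} (sp , t , _) (sp′ , t′ , _) with feeder-spec sp | feeder-spec sp′
    ... | l , e | l′ , e′ = trans (sym e) (trans (cong h (unlinked-unique l l′ (trans (sym t) t′))) e′)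

    Take : Fin k → Fin k → Set
    Take y i = first i ≡ y × ¬ H i

    take? : ∀ y i → Dec (Take y i)
    take? y i = first i ≟ y ×-dec ¬? (H? i)

    Shift : Fin k → Fin k → Set
    Shift y i = first i ≡ y × H i ⊎ Fill y i

    shift? : ∀ y i → Dec (Shift y i)
    shift? y i = (first i ≟ y ×-dec H? i) ⊎-dec fill? y i

    shift⇒¬take : ∀ {y i} → Shift y i → ¬ Take y i
    shift⇒¬take (inj₁ (_ , H-i)) (_ , ¬H-i) = ¬H-i H-i
    shift⇒¬take (inj₂ (_ , _ , f , _)) (f′ , _) = f f′

    stay : ∀ {y i} → ¬ Shift y i → ¬ Take y i → first i ≢ y
    stay {y} {i} ¬s ¬t f with H? i
    ... | yes H-i = ¬s (inj₁ (f , H-i))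
    ... | no ¬H-i = ¬t (f , ¬H-i)

    target : Fin k → Fin k → Fin k
    target y i = if′ (shift? y i) (h i) i

    private
      special-first : ∀ {y} → Special y → first y ≡ y
      special-first sp = first-base (inj₁ sp)

      fill-unlinked : ∀ {y i} → Fill y i → link i ≡ false → h i ≡ y
      fill-unlinked (sp , t , _) l =
        trans (cong h (unlinked-unique l (proj₁ (feeder-spec sp)) t)) (proj₂ (feeder-spec sp))

      -- The danger is that the feeder of `y` and the predecessor of `y` on its path both shift onto
      -- `y`. They would lie on the same path, beyond and before `y`; the last clause of `Fill` then
      -- excludes the feeder, because `y` has a predecessor.
      shift-injective-link : ∀ {y i i′} → Fill y i → Fill y i′ → link i ≡ false → link i′ ≡ true → h i ≢ h i′
      shift-injective-link {y} {i} {i′} F@(sp , t , _ , c) (_ , t′ , _) l l′ e =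
        ℕ.1+n≢0 (trans (sym pos-y) (c (trans (trans t (sym t′)) tail-y)
            (unlinked-last l (trans (sym tail-y) (trans t′ (sym t))))))
        where
        hi′ : h i′ ≡ y
        hi′ = trans (sym e) (fill-unlinked F l)
        tail-y : tail i′ ≡ tail y
        tail-y = trans (sym (tail-h l′)) (cong tail hi′)
        pos-y : pos y ≡ suc (pos i′)
        pos-y = trans (cong pos (sym hi′)) (pos-h l′)

      shift-injective : ∀ {y i i′} → Shift y i → Shift y i′ → h i ≡ h i′ → i ≡ i′
      shift-injective (inj₁ (_ , int , _)) _ e = sym (only-child int (sym e))
      shift-injective (inj₂ _) (inj₁ (_ , int , _)) e = only-child int e
      shift-injective {y} {i} {i′} (inj₂ F) (inj₂ F′) e with link i in l | link i′ in l′
      ... | true | true = link-inj l l′ e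
      ... | false | true = contradiction e (shift-injective-link F F′ l l′)
      ... | true | false = contradiction (sym e) (shift-injective-link F′ F l′ l)
      ... | false | false = unlinked-unique l l′ (trans (proj₁ (proj₂ F)) (sym (proj₁ (proj₂ F′))))

      -- Shifting stops only on entering the window of `y`. An unshifted facility of that window is
      -- taken, so it vacates its place and no two facilities collide.
      shift-onto-stay : ∀ {y i} → Shift y i → ¬ Shift y (h i) → first (h i) ≡ y
      shift-onto-stay {y} {i} (inj₁ (f , int , g)) _ with step-view int
      ... | shifted _ f′ _ = trans f′ f
      ... | taken g′ _ _ _ = contradiction (int , g) (good⇒¬H g′)
      ... | cut (_ , g′ , _) _ _ = contradiction (int , g) (good⇒¬H g′)
      shift-onto-stay {y} {i} (inj₂ F@(sp , t , f , c)) ¬s with link i in l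
      ... | false = trans (cong first (fill-unlinked F l)) (trans (special-first sp) refl)
      ... | true = decidable-stable (first (h i) ≟ y) λ f′ → ¬s (inj₂ (sp , trans (tail-h l) t , f′ , cond f′))
        where
        cond : first (h i) ≢ y → tail (h i) ≡ tail y → pos y ℕ.≤ pos (h i) → pos y ≡ 0
        cond f′ t′ p with pos y ℕ.≤? pos i
        ... | yes q = c (trans (sym (tail-h l)) t′) q
        ... | no q = contradiction (trans (cong first e) (special-first sp)) f′
          where
          e : h i ≡ y
          e = position-unique t′ (ℕ.≤-antisym (subst (ℕ._≤ pos y) (sym (pos-h l)) (ℕ.≰⇒> q)) p)

    target-injective : ∀ {y i i′} → ¬ Take y i → ¬ Take y i′ → target y i ≡ target y i′ → i ≡ i′
    target-injective {y} {i} {i′} ¬t ¬t′ e with shift? y i | shift? y i′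
    ... | yes s | yes s′ = shift-injective s s′ e
    ... | yes s | no ¬s′ = contradiction (subst (λ z → first z ≡ y) e
        (shift-onto-stay s (subst (λ z → ¬ Shift y z) (sym e) ¬s′))) (stay ¬s′ ¬t′)
    ... | no ¬s | yes s′ = contradiction (subst (λ z → first z ≡ y) (sym e)
        (shift-onto-stay s′ (subst (λ z → ¬ Shift y z) e ¬s))) (stay ¬s ¬t)
    ... | no _ | no _ = e

    Open : Fin k → Fin k → Set
    Open y v = ∃ λ i → ¬ Take y i × target y i ≡ v

    -- What the charging needs about a place that may close. `no-shift` separates it from the places
    -- closed by the swaps for shifted facilities, `where-is` bounds how often it is charged, and
    -- `children` offers the clients of each `o i` near it the place `o i` or, after a cut, `σ i`.
    record Closed (y v : Fin k) : Set where
      field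
        no-shift : ∀ {i} → h i ≡ v → ¬ H i
        where-is : first v ≡ y ⊎ Fill y v
        children : ∀ {i} → h i ≡ v → Take y i ⊎ Cut i × first v ≡ y × ¬ Take y i × target y i ≡ i

    shift-opens : ∀ {y i} → Shift y i → Open y (h i)
    shift-opens {y} {i} s = i , shift⇒¬take s , if-yes (shift? y i) s

    -- A place can be lost only at a leaf, behind a taken arc or behind a cut. A special first
    -- vertex is refilled by its feeder or by its predecessor, unless the window is a whole cycle.
    open-or-closed : ∀ y v → Open y v ⊎ Closed y v
    open-or-closed y v with first v ≟ y | fill? y v
    ... | no f | no ¬F = inj₁ (v , (λ t → f (proj₁ t)) , if-no (shift? y v) [ (λ s → f (proj₁ s)) , ¬F ]′)
    ... | no f | yes F@(sp , t , _ , c) = filled (pos v ℕ.≟ 0)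
      where
      v≢y : v ≢ y
      v≢y refl = f (special-first sp)
      filled : Dec (pos v ≡ 0) → Open y v ⊎ Closed y v
      -- Here `v` is a leaf: by saturation an unlinked arc into it would come from the last vertex
      -- of its own path, which is the feeder of `y`, and that would give `v ≡ y`.
      filled (yes p) = inj₂ record
        { no-shift = λ e → contradiction e no-child ; where-is = inj₂ F ; children = λ e → contradiction e no-child }
        where
        no-child : ∀ {i} → h i ≢ v
        no-child {i} refl with link i in l
        ... | true = ℕ.1+n≢0 (trans (sym (pos-h l)) p)
        ... | false = v≢y (trans (cong h (unlinked-unique l (proj₁ (feeder-spec sp))
                (trans (proj₁ (saturated l p)) (trans (sym (tail-0 p)) t)))) (proj₂ (feeder-spec sp)))
      filled (no p) with pred p
      ... | q , l , refl with fill? y q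
      ...   | yes Fq = inj₁ (shift-opens (inj₂ Fq))
      ...   | no ¬Fq = after (step-view int)
        where
        tail-q : tail q ≡ tail (feeder y)
        tail-q = trans (sym (tail-h l)) t
        first-q : first q ≡ y
        first-q = decidable-stable (first q ≟ y) λ f′ → ¬Fq (sp , tail-q , f′ , λ t′ p′ →
          c (trans (tail-h l) t′) (ℕ.≤-trans p′ (ℕ.≤-trans (ℕ.n≤1+n _) (ℕ.≤-reflexive (sym (pos-h l))))))
        -- The predecessor `q` lies in the window of `y`, so the refilling path is the path of `y`,
        -- and the last clause of `Fill` puts `y` at its start. By saturation no other unlinked arc
        -- enters this cycle; the arc of `q` is therefore internal, and as it leaves the window it
        -- is a cut.
        pos-y : pos y ≡ 0
        pos-y = c (trans (tail-h l) (trans (sym (first-tail q)) (cong tail first-q)))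
          (ℕ.≤-trans (subst (λ z → pos z ℕ.≤ pos q) first-q (first-pos q))
              (ℕ.≤-trans (ℕ.n≤1+n _) (ℕ.≤-reflexive (sym (pos-h l)))))
        sat : tail (feeder y) ≡ h (feeder y) × (∀ {i′} → link i′ ≡ false → tail (h i′) ≡ h (feeder y) → i′ ≡ feeder y)
        sat = saturated (proj₁ (feeder-spec sp)) (trans (cong pos (proj₂ (feeder-spec sp))) pos-y)
        int : Internal q
        int = l , λ { (i′ , l′ , e) → v≢y (trans (sym e) (trans
          (cong h (proj₂ sat l′ (trans (cong tail e) (trans t (proj₁ sat))))) (proj₂ (feeder-spec sp)))) }
        after : Step int → Open y (h q) ⊎ Closed y (h q)
        after (shifted _ f′ _) = contradiction (trans f′ first-q) f
        after (taken _ _ f′ _) = contradiction (trans f′ first-q) f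
        after (cut (_ , g , _) _ _) = inj₂ record
          { no-shift = λ e → subst (λ z → ¬ H z) (sym (only-child int e)) (good⇒¬H g)
          ; where-is = inj₂ F
          ; children = λ e → inj₁ (subst (Take y) (sym (only-child int e)) (first-q , good⇒¬H g)) }
    open-or-closed y v | yes refl | _ = window (view v)
      where
      window : (Special v ⊎ pos v ≡ 0) ⊎ (∃ λ i → Internal i × h i ≡ v) → Open y v ⊎ Closed y v
      window (inj₂ (q , int , refl)) with step-view int
      ... | shifted H-q f _ = inj₁ (shift-opens (inj₁ (sym f , H-q)))
      ... | taken g _ f _ = inj₂ record
        { no-shift = λ e → subst (λ z → ¬ H z) (sym (only-child int e)) (good⇒¬H g)
        ; where-is = inj₁ refl
        ; children = λ e → inj₁ (subst (Take y) (sym (only-child int e)) (sym f , good⇒¬H g)) }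
      -- Now `q` belongs to the preceding window and keeps its place in this swap. The clients of
      -- `o q` are the stranded ones; they go to `σ q`.
      ... | cut C@(_ , g , _) f _ = inj₂ record
        { no-shift = λ e → subst (λ z → ¬ H z) (sym (only-child int e)) (good⇒¬H g)
        ; where-is = inj₁ refl
        ; children = λ { {i} e → subst (λ z → Take y z ⊎ Cut z × first (h q) ≡ y × ¬ Take y z × target y z ≡ z)
            (sym (only-child int e)) (inj₂ (C , refl , (λ t → first-q (proj₁ t)) , if-no (shift? y q) ¬shift)) } }
        where
        first-q : first q ≢ first (h q)
        first-q e = before-first (subst (pos q ℕ.<_) (sym (pos-h (proj₁ int))) ℕ.≤-refl) (trans e f)
        ¬shift : ¬ Shift y q
        ¬shift (inj₁ (e , _)) = first-q e
        ¬shift (inj₂ (sp , _)) = proj₂ int (subst Special f sp)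
      window (inj₁ b) with special? v
      ... | no ¬sp = inj₂ record
        { no-shift = λ e → contradiction e no-child ; where-is = inj₁ refl ; children = λ e → contradiction e
            no-child }
        where
        no-child : ∀ {i} → h i ≢ v
        no-child {i} e with link i in l
        ... | false = ¬sp (i , l , e)
        ... | true = ℕ.1+n≢0 (trans (sym (pos-h l))
            (trans (cong pos e) ([ (λ sp → contradiction sp ¬sp) , (λ p → p) ]′ b)))
      ... | yes sp = refill (tail (feeder v) ≟ tail v) (pos v ℕ.≟ 0)
        where
        y≡v : y ≡ v
        y≡v = special-first sp
        u : Fin k
        u = feeder v
        hu : h u ≡ v
        hu = proj₂ (feeder-spec sp)
        opens : ∀ {i} → Fill v i → h i ≡ v → Open y v
        opens {i} F refl = shift-opens (inj₂ (subst (λ z → Fill z i) (sym y≡v) F))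
        refill : Dec (tail u ≡ tail v) → Dec (pos v ≡ 0) → Open y v ⊎ Closed y v
        refill (no t) _ = inj₁ (opens (sp , refl , (λ f → t (trans (sym (first-tail u)) (cong tail f))) ,
          λ t′ _ → contradiction t′ t) hu)
        refill (yes t) (no p) with pos-pred p
        ... | q , l , e , pq , tq = inj₁ (opens (sp , trans (sym tq) (sym t) ,
          before-first (subst (pos q ℕ.<_) (sym pq) ℕ.≤-refl) ,
          λ _ p′ → contradiction (subst (ℕ._≤ pos q) pq p′) (ℕ.<-irrefl refl)) e)
        -- The path starts at `v` and returns to it through the feeder `u`. If `u` is outside the
        -- window, it is shifted onto `v`; otherwise it is taken, and it is the only child of `v`.
        refill (yes t) (yes p) with fill? v u
        ... | yes F = inj₁ (opens F hu)
        ... | no ¬F = inj₂ record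
          { no-shift = λ e H-i → true≢false h (proj₁ (proj₁ H-i)) (unlinked e)
          ; where-is = inj₁ refl
          ; children = λ {i} e → inj₁ (subst (Take y) (sym (is-u e))
              (trans first-u (sym y≡v) , λ H-u → true≢false h (proj₁ (proj₁ H-u)) (proj₁ (feeder-spec sp)))) }
          where
          unlinked : ∀ {i} → h i ≡ v → link i ≡ false
          unlinked {i} e with link i in l
          ... | false = refl
          ... | true = contradiction (trans (sym (pos-h l)) (trans (cong pos e) p)) ℕ.1+n≢0
          is-u : ∀ {i} → h i ≡ v → i ≡ u
          is-u {i} e = unlinked-unique (unlinked e) (proj₁ (feeder-spec sp))
            (trans (proj₁ (saturated (unlinked e) (trans (cong pos e) p))) (trans e (sym (trans t (tail-0 p)))))
          first-u : first u ≡ v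
          first-u = decidable-stable (first u ≟ v) λ f → ¬F (sp , refl , f , λ _ _ → p)

  module _ (ℓ′ : ℕ) where
    module W = Windows ℓ′

    -- The colours of two phases advance in step modulo `suc ℓ′`, so an agreement at `x` can be
    -- traced back to the start of the segment, where the colours are the phases themselves.
    colour-phase : ∀ {φ φ′} x → W.colour φ x ≡ W.colour φ′ x → φ ≡ φ′
    colour-phase {φ} {φ′} = path-induction _
      (λ b e → trans (sym (W.colour-base φ b)) (trans e (W.colour-base φ′ b))) ind
      where
      ind : ∀ {i} → Internal i → (W.colour φ i ≡ W.colour φ′ i → φ ≡ φ′) →
        W.colour φ (h i) ≡ W.colour φ′ (h i) → φ ≡ φ′
      ind int ih e with W.step-view φ int | W.step-view φ′ int
      ... | W.shifted _ _ c | W.shifted _ _ c′ = ih (trans (sym c) (trans e c′))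
      ... | W.taken _ _ _ c | W.taken _ _ _ c′ = ih (ℕ.suc-injective (trans (sym c) (trans e c′)))
      ... | W.cut (_ , _ , c) _ _ | W.cut (_ , _ , c′) _ _ = ih (trans c (sym c′))
      ... | W.taken _ _ _ c | W.cut _ _ c′ = contradiction (trans (sym c) (trans e c′)) ℕ.1+n≢0
      ... | W.cut _ _ c | W.taken _ _ _ c′ = contradiction (sym (trans (sym c) (trans e c′))) ℕ.1+n≢0
      ... | W.shifted H-i _ _ | W.taken g _ _ _ = contradiction H-i (W.good⇒¬H φ g)
      ... | W.shifted H-i _ _ | W.cut (_ , g , _) _ _ = contradiction H-i (W.good⇒¬H φ g)
      ... | W.taken g _ _ _ | W.shifted H-i _ _ = contradiction H-i (W.good⇒¬H φ g)
      ... | W.cut (_ , g , _) _ _ | W.shifted H-i _ _ = contradiction H-i (W.good⇒¬H φ g)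

    cut-phase : ∀ {φ φ′ i} → W.Cut φ i → W.Cut φ′ i → φ ≡ φ′
    cut-phase {i = i} (_ , _ , c) (_ , _ , c′) = colour-phase i (trans c (sym c′))

-- Cardinalities of subsets through enumerations

element : ∀ {n} (p : Subset n) → Fin ∣ p ∣ → Fin n
element (true ∷ p) zero = zero
element (true ∷ p) (suc i) = suc (element p i)
element (false ∷ p) i = suc (element p i)

element-∈ : ∀ {n} (p : Subset n) i → element p i ∈ p
element-∈ (true ∷ p) zero = here
element-∈ (true ∷ p) (suc i) = there (element-∈ p i)
element-∈ (false ∷ p) i = there (element-∈ p i)

element-injective : ∀ {n} (p : Subset n) → Injective _≡_ _≡_ (element p)
element-injective (true ∷ p) {zero} {zero} e = refl
element-injective (true ∷ p) {suc i} {suc j} e = cong suc (element-injective p (suc-injective e))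
element-injective (false ∷ p) e = element-injective p (suc-injective e)

index : ∀ {n} (p : Subset n) {x} → x ∈ p → ∃ λ i → element p i ≡ x
index (true ∷ p) here = zero , refl
index (true ∷ p) (there x∈p) with index p x∈p
... | i , e = suc i , cong suc e
index (false ∷ p) (there x∈p) with index p x∈p
... | i , e = i , cong suc e

index-injective : ∀ {n} (p : Subset n) {x y} (x∈p : x ∈ p) (y∈p : y ∈ p) →
  proj₁ (index p x∈p) ≡ proj₁ (index p y∈p) → x ≡ y
index-injective p x∈p y∈p e =
  trans (sym (proj₂ (index p x∈p))) (trans (cong (element p) e) (proj₂ (index p y∈p)))

x∈p─q⇒x∉q : ∀ {n} (p q : Subset n) {x} → x ∈ p ─ q → x ∉ q
x∈p─q⇒x∉q (_ ∷ p) (true ∷ q) () here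
x∈p─q⇒x∉q (_ ∷ p) (_ ∷ q) (there m) (there m′) = x∈p─q⇒x∉q p q m m′

∣p─q∣+∣p∩q∣≡∣p∣ : ∀ {n} (p q : Subset n) → ∣ p ─ q ∣ ℕ.+ ∣ p ∩ q ∣ ≡ ∣ p ∣
∣p─q∣+∣p∩q∣≡∣p∣ [] [] = refl
∣p─q∣+∣p∩q∣≡∣p∣ (true ∷ p) (true ∷ q) = trans (ℕ.+-suc _ _) (cong suc (∣p─q∣+∣p∩q∣≡∣p∣ p q))
∣p─q∣+∣p∩q∣≡∣p∣ (true ∷ p) (false ∷ q) = cong suc (∣p─q∣+∣p∩q∣≡∣p∣ p q)
∣p─q∣+∣p∩q∣≡∣p∣ (false ∷ p) (true ∷ q) = ∣p─q∣+∣p∩q∣≡∣p∣ p q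
∣p─q∣+∣p∩q∣≡∣p∣ (false ∷ p) (false ∷ q) = ∣p─q∣+∣p∩q∣≡∣p∣ p q

∣p─q∣≡∣q─p∣ : ∀ {n} (p q : Subset n) → ∣ p ∣ ≡ ∣ q ∣ → ∣ p ─ q ∣ ≡ ∣ q ─ p ∣
∣p─q∣≡∣q─p∣ p q e = ℕ.+-cancelʳ-≡ ∣ p ∩ q ∣ _ _ (trans (∣p─q∣+∣p∩q∣≡∣p∣ p q)
  (trans e (trans (sym (∣p─q∣+∣p∩q∣≡∣p∣ q p)) (cong (λ r → ∣ q ─ p ∣ ℕ.+ ∣ r ∣) (∩-comm q p)))))

⊎-injective⇒≤ : ∀ {a b c d} (g : Fin a ⊎ Fin b → Fin c ⊎ Fin d) → Injective _≡_ _≡_ g →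
  a ℕ.+ b ℕ.≤ c ℕ.+ d
⊎-injective⇒≤ {a} {b} {c} {d} g g-inj = injective⇒≤ {f = λ i → join c d (g (splitAt a i))} λ {i} {j} e →
  trans (sym (join-splitAt a b i)) (trans (cong (join a b) (g-inj
    (trans (sym (splitAt-join c d _)) (trans (cong (splitAt c) e) (splitAt-join c d _))))) (join-splitAt a b j))

-- A set S of k elements loses few of them to S′ if all but few of k slots, told apart by
-- colours below p, hold distinct elements of S that remain in S′.
∣p─q∣≤ : ∀ {k n p} (S S′ : Subset n) → ∣ S ∣ ≡ k → {N : Fin k → Set} → (∀ i → Dec (N i)) →
  (colour : Fin k → ℕ) → (∀ i → colour i ℕ.< p) → (∀ {i i′} → N i → N i′ → colour i ≡ colour i′ → i ≡ i′) →
  (kept : Fin k → Fin n) → (∀ i → kept i ∈ S) → (∀ {i} → ¬ N i → kept i ∈ S′) →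
  (∀ {i i′} → ¬ N i → ¬ N i′ → kept i ≡ kept i′ → i ≡ i′) → ∣ S ─ S′ ∣ ℕ.≤ p
∣p─q∣≤ {k} {n} {p} S S′ ∣S∣ {N} N? colour col<p col-inj kept ∈S ∈S′ kept-inj =
  ℕ.+-cancelʳ-≤ k _ _ (subst (∣ S ─ S′ ∣ ℕ.+ k ℕ.≤_) (trans (cong (ℕ._+ p) ∣S∣) (ℕ.+-comm k p))
    (⊎-injective⇒≤ φ φ-inj))
  where
  lost∈S : ∀ a → element (S ─ S′) a ∈ S
  lost∈S a = p─q⊆p S S′ (element-∈ (S ─ S′) a)
  slot : ∀ i → Dec (N i) → Fin ∣ S ∣ ⊎ Fin p
  slot i (yes _) = inj₂ (fromℕ< (col<p i))
  slot i (no _) = inj₁ (proj₁ (index S (∈S i)))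
  -- Lost elements and slots are injected together into `S` and the colours: a slot in `N` goes to
  -- its colour, any other to its kept element, which is not lost. With `∣ S ∣ ≡ k` this cancels to
  -- the claim.
  φ : Fin ∣ S ─ S′ ∣ ⊎ Fin k → Fin ∣ S ∣ ⊎ Fin p
  φ (inj₁ a) = inj₁ (proj₁ (index S (lost∈S a)))
  φ (inj₂ i) = slot i (N? i)
  lost≢slot : ∀ a i N?i → φ (inj₁ a) ≢ slot i N?i
  lost≢slot a i (no ¬Ni) e = x∈p─q⇒x∉q S S′ (element-∈ (S ─ S′) a)
    (subst (_∈ S′) (sym (index-injective S (lost∈S a) (∈S i) (inj₁-injective e))) (∈S′ ¬Ni))
  slot-inj : ∀ i i′ N?i N?i′ → slot i N?i ≡ slot i′ N?i′ → i ≡ i′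
  slot-inj i i′ (yes Ni) (yes Ni′) e = col-inj Ni Ni′ (fromℕ<-injective _ _ (col<p i) (col<p i′) (inj₂-injective e))
  slot-inj i i′ (no ¬Ni) (no ¬Ni′) e = kept-inj ¬Ni ¬Ni′ (index-injective S (∈S i) (∈S i′) (inj₁-injective e))
  φ-inj : Injective _≡_ _≡_ φ
  φ-inj {inj₁ a} {inj₁ b} e =
    cong inj₁ (element-injective (S ─ S′) (index-injective S (lost∈S a) (lost∈S b) (inj₁-injective e)))
  φ-inj {inj₁ a} {inj₂ i} e = contradiction e (lost≢slot a i (N? i))
  φ-inj {inj₂ i} {inj₁ a} e = contradiction (sym e) (lost≢slot a i (N? i))
  φ-inj {inj₂ i} {inj₂ i′} e = cong inj₂ (slot-inj i i′ (N? i) (N? i′) e)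

module _ {k n : ℕ} (s : Fin k → Fin n) where

  image : Subset n
  image = tabulate (λ v → does (any? (λ i → s i ≟ v)))

  image-∈ : ∀ i → s i ∈ image
  image-∈ i = lookup⇒[]= (s i) image
    (trans (lookup∘tabulate _ (s i)) (dec-true (any? (λ i′ → s i′ ≟ s i)) (i , refl)))

  ∈-image : ∀ {v} → v ∈ image → ∃ λ i → s i ≡ v
  ∈-image {v} m with any? (λ i → s i ≟ v) | trans (sym (lookup∘tabulate (λ v → does (any? (λ i → s i ≟ v))) v))
      ([]=⇒lookup m)
  ... | yes r | _ = r
  ... | no _ | ()

  ∣image∣ : Injective _≡_ _≡_ s → ∣ image ∣ ≡ k
  ∣image∣ s-inj = ℕ.≤-antisym
    (injective⇒≤ {f = λ i → proj₁ (∈-image (element-∈ image i))} λ {i} {j} e → element-injective image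
      (trans (sym (proj₂ (∈-image (element-∈ image i)))) (trans (cong s e) (proj₂ (∈-image (element-∈ image j))))))
    (injective⇒≤ {f = λ i → proj₁ (index image (image-∈ i))} λ {i} {j} e →
      s-inj (index-injective image (image-∈ i) (image-∈ j) e))

-- Minima of rational functions over finite types

argmin : ∀ {m} → Fin m → (f : Fin m → ℚ) → ∃ λ i → ∀ j → f i ≤ f j
argmin {suc zero} _ f = zero , λ { zero → ≤-refl }
argmin {suc (suc m)} _ f with argmin zero (λ i → f (suc i))
... | i , min with ≤-total (f zero) (f (suc i))
...   | inj₁ p = zero , λ { zero → ≤-refl ; (suc j) → ≤-trans p (min j) }
...   | inj₂ p = suc i , λ { zero → p ; (suc j) → min j }

module _ {X : Set} {P : X → Set} (P? : ∀ x → Dec (P x)) (q : X → ℚ) where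

  argmin-list : ∀ xs {x₀} → P x₀ → ∃ λ x → P x × q x ≤ q x₀ × (∀ {x′} → x′ List.∈ xs → P x′ → q x ≤ q x′)
  argmin-list [] {x₀} p₀ = x₀ , p₀ , ≤-refl , λ ()
  argmin-list (y ∷ xs) p₀ with argmin-list xs p₀ | P? y
  ... | x , p , x≤x₀ , min | no ¬py =
    x , p , x≤x₀ , λ { (Any.here refl) py → contradiction py ¬py ; (Any.there m) → min m }
  ... | x , p , x≤x₀ , min | yes py with ≤-total (q x) (q y)
  ...   | inj₁ x≤y = x , p , x≤x₀ , λ { (Any.here refl) _ → x≤y ; (Any.there m) → min m }
  ...   | inj₂ y≤x = y , py , ≤-trans y≤x x≤x₀ ,
                     λ { (Any.here refl) _ → ≤-refl ; (Any.there m) p′ → ≤-trans y≤x (min m p′) }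

vectors : ∀ n k → List (Vec (Fin n) k)
vectors n zero = [] ∷ []
vectors n (suc k) = cartesianProductWith _∷_ (allFin n) (vectors n k)

∈-vectors : ∀ {n k} (v : Vec (Fin n) k) → v List.∈ vectors n k
∈-vectors [] = Any.here refl
∈-vectors (a ∷ v) = ∈-cartesianProductWith⁺ _∷_ (∈-allFin a) (∈-vectors v)

-- Costs of solutions, and what local optimality says about them.

module Cost (I : Instance) where
  open Instance I

  -- The demand is extended by zero outside `D`, so that all sums range over all nodes.
  weight : Fin n → ℚ
  weight j = on (j ∈? D) (ℕ→ℚ (d j))

  weight-nonneg : ∀ j → 0ℚ ≤ weight j
  weight-nonneg j = on-nonneg (j ∈? D) (ℕ→ℚ-nonneg (d j))

  serviceCost : (Fin k → Fin n) → (Fin n → Fin k) → ℚ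
  serviceCost s r = ∑ (λ j → weight j * c j (s (r j)))

  serviceCost-mono : ∀ s r s′ r′ → (∀ j → c j (s (r j)) ≤ c j (s′ (r′ j))) → serviceCost s r ≤ serviceCost s′ r′
  serviceCost-mono s r s′ r′ p = ∑-mono (λ j → *-mono-≤ˡ (weight-nonneg j) (p j))

  Nearest : (Fin k → Fin n) → (Fin n → Fin k) → Set
  Nearest s r = ∀ j i → c j (s (r j)) ≤ c j (s i)

  assignCost-elim : ∀ {s a} → IsAssignCost I s a → ∃ λ r → Nearest s r × a ≡ serviceCost s r
  assignCost-elim {s} (δ , nd , w , ws , a≡) =
    (λ j → proj₁ (proj₁ (nd j))) ,
    (λ j i → subst (_≤ c j (s i)) (proj₂ (proj₁ (nd j))) (proj₂ (nd j) i)) ,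
    trans a≡ (∑-cong eq)
    where
    eq : ∀ j → w j ≡ weight j * c j (s (proj₁ (proj₁ (nd j))))
    eq j with j ∈? D
    ... | yes j∈D = trans (proj₁ (ws j) j∈D) (cong (ℕ→ℚ (d j) *_) (proj₂ (proj₁ (nd j))))
    ... | no j∉D = trans (proj₂ (ws j) j∉D) (sym (ℚ.*-zeroˡ (c j (s (proj₁ (proj₁ (nd j)))))))

  assignCost-intro : ∀ {s r} → Nearest s r → IsAssignCost I s (serviceCost s r)
  assignCost-intro {s} {r} near = (λ j → c j (s (r j))) , (λ j → (r j , refl) , near j) ,
    (λ j → weight j * c j (s (r j))) , (λ j → inside j , outside j) , refl
    where
    inside : ∀ j → j ∈ D → weight j * c j (s (r j)) ≡ ℕ→ℚ (d j) * c j (s (r j))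
    inside j j∈D = cong (_* c j (s (r j))) (on-yes (j ∈? D) j∈D)
    outside : ∀ j → ¬ (j ∈ D) → weight j * c j (s (r j)) ≡ 0ℚ
    outside j j∉D = trans (cong (_* c j (s (r j))) (on-no (j ∈? D) j∉D)) (ℚ.*-zeroˡ (c j (s (r j))))

  -- `r` supplies the element of `Fin k` from which the search for a minimum starts.
  nearest : (Fin n → Fin k) → (Fin k → Fin n) → Fin n → Fin k
  nearest r s j = proj₁ (argmin (r j) (λ i → c j (s i)))

  nearest-Nearest : ∀ r s → Nearest s (nearest r s)
  nearest-Nearest r s j = proj₂ (argmin (r j) (λ i → c j (s i)))

  -- A facility that shares its final location with another one may as well stay at home:
  -- this does not uncover any location.
  separate : ∀ s → ∃ λ s′ → Injective _≡_ _≡_ s′ × moveCost I s′ ≤ moveCost I s × (∀ i → ∃ λ i′ → s′ i′ ≡ s i)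
  separate s = go s (<-wellFounded _)
    where
    away : (Fin k → Fin n) → ℕ
    away s = count (λ i → ¬? (s i ≟ loc i))
    go : ∀ s → Acc ℕ._<_ (away s) →
      ∃ λ s′ → Injective _≡_ _≡_ s′ × moveCost I s′ ≤ moveCost I s × (∀ i → ∃ λ i′ → s′ i′ ≡ s i)
    go s (acc rec) with any? (λ i → any? (λ i′ → s i ≟ s i′ ×-dec ¬? (i ≟ i′) ×-dec ¬? (s i ≟ loc i)))
    ... | no none = s , inj , ≤-refl , λ i → i , refl
      where
      inj : Injective _≡_ _≡_ s
      inj {i} {i′} e with i ≟ i′ | s i ≟ loc i | s i′ ≟ loc i′
      ... | yes p | _ | _ = p
      ... | no p | no q | _ = contradiction (i , i′ , e , p , q) none
      ... | no p | yes _ | no q = contradiction (i′ , i , sym e , (λ r → p (sym r)) , q) none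
      ... | no p | yes q | yes q′ = loc-inj (trans (sym q) (trans e q′))
    ... | yes (a , a′ , e , a≢a′ , q) with go s₁ (rec (count-mono-< (λ i → ¬? (s₁ i ≟ loc i)) (λ i → ¬? (s i ≟ loc i))
            (λ i → fewer i) a (λ r → r (if-yes (a ≟ a) refl)) q))
      where
      s₁ : Fin k → Fin n
      s₁ i = if′ (i ≟ a) (loc i) (s i)
      fewer : ∀ i → s₁ i ≢ loc i → s i ≢ loc i
      fewer i p r with i ≟ a
      ... | yes _ = p refl
      ... | no _ = p r
    ...   | s′ , inj , cost , cover = s′ , inj , ≤-trans cost (∑-mono cheaper) , covered
      where
      cheaper : ∀ i → c (loc i) (if′ (i ≟ a) (loc i) (s i)) ≤ c (loc i) (s i)
      cheaper i with i ≟ a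
      ... | yes _ = ≤-trans (≤-reflexive (c-refl (loc i))) (c-nonneg (loc i) (s i))
      ... | no _ = ≤-refl
      covered : ∀ i → ∃ λ i′ → s′ i′ ≡ s i
      covered i with i ≟ a
      ... | no p = proj₁ (cover i) , trans (proj₂ (cover i)) (if-no (i ≟ a) p)
      ... | yes refl = proj₁ (cover a′) ,
              trans (proj₂ (cover a′)) (trans (if-no (a′ ≟ a) (λ r → a≢a′ (sym r))) (sym e))

  matching? : ∀ S s → Dec (IsMatching I S s)
  matching? S s = map′ (λ f {i} {i′} → f i i′) (λ f i i′ → f {i} {i′})
    (all? (λ i → all? (λ i′ → s i ≟ s i′ →-dec i ≟ i′))) ×-dec all? (λ i → s i ∈? S)

  matching-tabulate : ∀ {S s} → IsMatching I S s → IsMatching I S (lookup (tabulate s))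
  matching-tabulate {S} {s} (inj , ∈S) =
    (λ {i} {i′} e → inj (trans (sym (lookup∘tabulate s i)) (trans e (lookup∘tabulate s i′)))) ,
    λ i → subst (_∈ S) (sym (lookup∘tabulate s i)) (∈S i)

  module _ (r : Fin n → Fin k) where

    cost : Vec (Fin n) k → ℚ
    cost v = moveCost I (lookup v) + serviceCost (lookup v) (nearest r (lookup v))

    cost-tabulate : ∀ s r′ → cost (tabulate s) ≤ moveCost I s + serviceCost s r′
    cost-tabulate s r′ = +-mono-≤ (∑-mono λ i → ≤-reflexive (cong (c (loc i)) (lookup∘tabulate s i)))
      (serviceCost-mono (lookup (tabulate s)) (nearest r (lookup (tabulate s))) s r′ λ j →
        ≤-trans (nearest-Nearest r (lookup (tabulate s)) j (r′ j))
            (≤-reflexive (cong (c j) (lookup∘tabulate s (r′ j)))))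

    -- Local optimality speaks only of sets whose cost is given, so the minimum over matchings has
    -- to be attained. It is found by running through all vectors in `Fin n`.
    cost-exists : ∀ S s → IsMatching I S s → ∃ λ x → IsCostOfSet I S x × x ≤ moveCost I s + serviceCost s r
    cost-exists S s matching
      with argmin-list (λ v → matching? S (lookup v)) cost (vectors n k) {tabulate s} (matching-tabulate matching)
    ... | v , mv , v≤ , min = cost v ,
          ((lookup v , mv , _ , assignCost-intro (nearest-Nearest r (lookup v)) , refl) , minimal) ,
          ≤-trans v≤ (cost-tabulate s r)
      where
      minimal : ∀ s′ → IsMatching I S s′ → ∀ a′ → IsAssignCost I s′ a′ → cost v ≤ moveCost I s′ + a′
      minimal s′ m′ a′ as′ with assignCost-elim as′
      ... | r′ , _ , a≡ = ≤-trans (min (∈-vectors (tabulate s′)) (matching-tabulate m′))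
        (subst (λ z → cost (tabulate s′) ≤ moveCost I s′ + z) (sym a≡) (cost-tabulate s′ r′))

  LocallyOptimal : ℕ → Subset n → Set
  LocallyOptimal p S = ∀ (S′ : Subset n) → ∣ S′ ∣ ≡ k → ∣ S ─ S′ ∣ ≡ ∣ S′ ─ S ∣ → ∣ S ─ S′ ∣ ℕ.≤ p
    → ∀ x x′ → IsCostOfSet I S x → IsCostOfSet I S′ x′ → x ≤ x′

  -- Only the facilities in N leave the locations of S.
  swap-no-better : ∀ {p S x σ} → ∣ S ∣ ≡ k → LocallyOptimal p S → IsCostOfSet I S x → IsMatching I S σ →
    (s : Fin k → Fin n) {N : Fin k → Set} (N? : ∀ i → Dec (N i)) (colour : Fin k → ℕ) (target : Fin k → Fin k) →
    (∀ i → colour i ℕ.< p) → (∀ {i i′} → N i → N i′ → colour i ≡ colour i′ → i ≡ i′) →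
    (∀ {i} → ¬ N i → s i ≡ σ (target i)) →
    (∀ {i i′} → ¬ N i → ¬ N i′ → target i ≡ target i′ → i ≡ i′) →
    (r : Fin n → Fin k) → x ≤ moveCost I s + serviceCost s r
  swap-no-better {p} {S} {x} {σ} ∣S∣ optimal cost-S (σ-inj , σ-∈) s {N} N? colour target col<p col-inj s≡ target-inj
      r =
    -- The locations `s` of a test swap may coincide; after `separate` they form a genuine set of
    -- `k` locations that is no more expensive.
    beat (separate s)
    where
    beat : (∃ λ s′ → Injective _≡_ _≡_ s′ × moveCost I s′ ≤ moveCost I s × (∀ i → ∃ λ i′ → s′ i′ ≡ s i)) →
      x ≤ moveCost I s + serviceCost s r
    beat (s′ , s′-inj , cost-≤ , cover) = compare (cost-exists r′ (image s′) s′ (s′-inj , image-∈ s′))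
      where
      r′ : Fin n → Fin k
      r′ j = proj₁ (cover (r j))
      ∣S′∣ : ∣ image s′ ∣ ≡ k
      ∣S′∣ = ∣image∣ s′ s′-inj
      kept : ∀ {i} → ¬ N i → σ (target i) ∈ image s′
      kept {i} ¬Ni = subst (_∈ image s′) (trans (proj₂ (cover i)) (s≡ ¬Ni)) (image-∈ s′ (proj₁ (cover i)))
      few : ∣ S ─ image s′ ∣ ℕ.≤ p
      few = ∣p─q∣≤ S (image s′) ∣S∣ N? colour col<p col-inj (λ i → σ (target i)) (λ i → σ-∈ (target i)) kept
        (λ ¬Ni ¬Ni′ e → target-inj ¬Ni ¬Ni′ (σ-inj e))
      compare : (∃ λ x′ → IsCostOfSet I (image s′) x′ × x′ ≤ moveCost I s′ + serviceCost s′ r′) →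
        x ≤ moveCost I s + serviceCost s r
      compare (x′ , cost-S′ , x′≤) = ≤-trans
        (optimal (image s′) ∣S′∣ (∣p─q∣≡∣q─p∣ S (image s′) (trans ∣S∣ (sym ∣S′∣))) few x x′ cost-S cost-S′)
        (≤-trans x′≤ (+-mono-≤ cost-≤ (serviceCost-mono s′ r′ s r λ j → ≤-reflexive
            (cong (c j) (proj₂ (cover (r j)))))))

-- Test swaps and the charges to facilities and clients.

2ℚ 4ℚ : ℚ
2ℚ = ℕ→ℚ 2
4ℚ = ℕ→ℚ 4

module Analysis (I : Instance) {p : ℕ} {S : Subset (Instance.n I)} {x : ℚ}
  {σ : Fin (Instance.k I) → Fin (Instance.n I)} (b : Fin (Instance.n I) → Fin (Instance.k I))
  (o : Fin (Instance.k I) → Fin (Instance.n I)) (a : Fin (Instance.n I) → Fin (Instance.k I))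
  (∣S∣ : ∣ S ∣ ≡ Instance.k I) (optimal : Cost.LocallyOptimal I p S) (cost-S : IsCostOfSet I S x)
  (matching : IsMatching I S σ) (x≡ : x ≡ moveCost I σ + Cost.serviceCost I σ b)
  (nearest-b : Cost.Nearest I σ b) where

  open Instance I
  open Cost I

  -- `γ i` bounds the extra distance from `o i` to `σ i` compared with the nearest place of `S`.
  f f* e γ : Fin k → ℚ
  f i = c (loc i) (σ i)
  f* i = c (loc i) (o i)

  h : Fin k → Fin k
  h i = b (o i)

  e i = c (o i) (σ (h i))
  γ i = f i + f* i - e i

  C C* : Fin n → ℚ
  C j = c j (σ (b j))
  C* j = c j (o (a j))

  f*≥0 : ∀ i → 0ℚ ≤ f* i
  f*≥0 i = c-nonneg (loc i) (o i)

  e≥0 : ∀ i → 0ℚ ≤ e i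
  e≥0 i = c-nonneg (o i) (σ (h i))

  C*≥0 : ∀ j → 0ℚ ≤ C* j
  C*≥0 j = c-nonneg j (o (a j))

  C≥0 : ∀ j → 0ℚ ≤ C j
  C≥0 j = c-nonneg j (σ (b j))

  2C*≥0 : ∀ j → 0ℚ ≤ 2ℚ * C* j
  2C*≥0 j = *≥0 (ℕ→ℚ-nonneg 2) (C*≥0 j)

  e≤f+f* : ∀ i → e i ≤ f i + f* i
  e≤f+f* i = ≤-trans (nearest-b (o i) i) (≤-trans (c-tri (o i) (loc i) (σ i))
    (≤-reflexive (trans (ℚ.+-comm _ (f i)) (cong (f i +_) (c-sym (o i) (loc i))))))

  γ≥0 : ∀ i → 0ℚ ≤ γ i
  γ≥0 i = diff≥0 (e≤f+f* i)

  e≤C*+C : ∀ j → e (a j) ≤ C* j + C j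
  e≤C*+C j = ≤-trans (nearest-b (o (a j)) (b j)) (≤-trans (c-tri (o (a j)) j (σ (b j)))
    (≤-reflexive (cong (_+ C j) (c-sym (o (a j)) j))))

  -- The detour goes from `j` to its optimal place `o (a j)` and from there to the place of `S`
  -- nearest to it.
  to-h : ∀ j → c j (σ (h (a j))) ≤ C j + 2ℚ * C* j
  to-h j = ≤-trans (c-tri j (o (a j)) (σ (h (a j)))) (≤-trans (ℚ.+-monoʳ-≤ (C* j) (e≤C*+C j))
    (≤-reflexive (solve 2 (λ s t → s :+ (s :+ t) := t :+ con 2ℚ :* s) refl (C* j) (C j))))

  to-a : ∀ j → c j (σ (a j)) ≤ C j + (2ℚ * C* j + γ (a j))
  to-a j = ≤-trans (c-tri j (o (a j)) (σ (a j))) (≤-trans (ℚ.+-monoʳ-≤ (C* j) (c-tri (o (a j)) (loc (a j)) (σ (a j))))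
    (≤-trans (≤-reflexive (cong (λ z → C* j + (z + f (a j))) (c-sym (o (a j)) (loc (a j)))))
      (≤-by-diff _ (diff≥0 (e≤C*+C j)) (solve 5 (λ s t f f* e →
        t :+ (con 2ℚ :* s :+ (f :+ f* :- e)) := s :+ (f* :+ f) :+ (s :+ t :- e)) refl
        (C* j) (C j) (f (a j)) (f* (a j)) (e (a j))))))

  -- The bookkeeping common to all test swaps: `P i` is a movement cost certainly saved by facility
  -- `i`, `Q j` a bound on the additional distance of client `j`. A local optimum cannot save more
  -- than it pays.
  swap : (s : Fin k → Fin n) {N : Fin k → Set} (N? : ∀ i → Dec (N i)) (colour : Fin k → ℕ) (target : Fin k → Fin k) →
    (∀ i → colour i ℕ.< p) → (∀ {i i′} → N i → N i′ → colour i ≡ colour i′ → i ≡ i′) →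
    (∀ {i} → ¬ N i → s i ≡ σ (target i)) →
    (∀ {i i′} → ¬ N i → ¬ N i′ → target i ≡ target i′ → i ≡ i′) →
    (P : Fin k → ℚ) (Q : Fin n → ℚ) → (∀ i → c (loc i) (s i) + P i ≤ f i) →
    (∀ j → ∃ λ i → c j (s i) ≤ C j + Q j) → ∑ P ≤ ∑ (λ j → weight j * Q j)
  swap s N? colour target col<p col-inj s≡ target-inj P Q moves serves = ≤-by-diff _
    (+≥0 (diff≥0 total) (+≥0 (diff≥0 move) (diff≥0 serve)))
    (solve 6 (λ F C M C′ P R → R := P :+ (M :+ C′ :- (F :+ C) :+ (F :- (M :+ P) :+ (C :+ R :- C′)))) refl
      (∑ f) (serviceCost σ b) (moveCost I s) (serviceCost s r) (∑ P) (∑ (λ j → weight j * Q j)))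
    where
    r : Fin n → Fin k
    r j = proj₁ (serves j)
    total : ∑ f + serviceCost σ b ≤ moveCost I s + serviceCost s r
    total = subst (_≤ moveCost I s + serviceCost s r) x≡
      (swap-no-better ∣S∣ optimal cost-S matching s N? colour target col<p col-inj s≡ target-inj r)
    move : moveCost I s + ∑ P ≤ ∑ f
    move = ≤-trans (≤-reflexive (sym (∑-+ (λ i → c (loc i) (s i)) P))) (∑-mono moves)
    serve : serviceCost s r ≤ serviceCost σ b + ∑ (λ j → weight j * Q j)
    serve = ≤-trans (∑-mono λ j → *-mono-≤ˡ (weight-nonneg j) (proj₂ (serves j)))
      (≤-reflexive (trans (∑-cong λ j → ℚ.*-distribˡ-+ (weight j) (C j) (Q j))
                          (∑-+ (λ j → weight j * C j) (λ j → weight j * Q j))))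

  module Scheme (L : Paths h) (saturated : Saturated h L) (good : Fin k → Bool) where

    open Segments h L saturated good public

    ShiftInto : Fin k → Set
    ShiftInto v = ∃ λ i → H i × h i ≡ v

    shiftInto? : ∀ v → Dec (ShiftInto v)
    shiftInto? v = any? (λ i → H? i ×-dec h i ≟ v)

    saving : Fin k → ℚ
    saving i = f i - f* i - on (H? i) (e i)

    -- the swap that moves facility h i to o i
    single-swap : 0 ℕ.< p → ∀ {i} → Internal i → - e i ≤
      ∑ (λ j → weight j * (on (a j ≟ i) (C* j - C j) + on (h i ≟ b j) (2ℚ * C* j)))
    single-swap 0<p {i} int = subst (_≤ ∑ (λ j → weight j * Q j)) (∑-select (h i) (λ _ → - e i))
      (swap s (λ v → h i ≟ v) (λ _ → 0) (λ v → v) (λ _ → 0<p) (λ p q _ → trans (sym p) q)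
        (λ {v} q → if-no (h i ≟ v) q) (λ _ _ e → e) (λ v → on (h i ≟ v) (- e i)) Q moves serves)
      where
      s : Fin k → Fin n
      s v = if′ (h i ≟ v) (o i) (σ v)
      Q : Fin n → ℚ
      Q j = on (a j ≟ i) (C* j - C j) + on (h i ≟ b j) (2ℚ * C* j)
      moves : ∀ v → c (loc v) (s v) + on (h i ≟ v) (- e i) ≤ f v
      moves v with h i ≟ v
      ... | no _ = ≤-reflexive (ℚ.+-identityʳ (f v))
      ... | yes refl = ≤-trans (ℚ.+-monoˡ-≤ (- e i) (c-tri (loc (h i)) (σ (h i)) (o i)))
        (≤-reflexive (trans (cong (λ z → f (h i) + z - e i) (c-sym (σ (h i)) (o i)))
          (solve 2 (λ f e → f :+ e :- e := f) refl (f (h i)) (e i))))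
      serves : ∀ j → ∃ λ v → c j (s v) ≤ C j + Q j
      serves j with a j ≟ i | h i ≟ b j
      ... | yes refl | d = h i , ≤-trans (≤-reflexive (cong (c j) (if-yes (h i ≟ h i) refl)))
        (≤-by-diff (on d (2ℚ * C* j)) (on-nonneg d (2C*≥0 j))
          (solve 3 (λ s t q → t :+ (s :- t :+ q) := s :+ q) refl (C* j) (C j) (on d (2ℚ * C* j))))
      ... | no _ | no q = b j , ≤-trans (≤-reflexive (cong (c j) (if-no (h i ≟ b j) q)))
        (≤-reflexive (sym (ℚ.+-identityʳ (C j))))
      -- The place of `h (a j)` is still open, since `i` is the only child of `h i`.
      ... | no a≢i | yes _ = h (a j) , ≤-trans
          (≤-reflexive (cong (c j) (if-no (h i ≟ h (a j)) λ q → a≢i (only-child int (sym q)))))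
        (≤-trans (to-h j) (≤-reflexive (cong (C j +_) (sym (ℚ.+-identityˡ (2ℚ * C* j))))))

    shiftedChange : Fin n → ℚ
    shiftedChange j = on (H? (a j)) (C* j - C j) + on (shiftInto? (b j)) (2ℚ * C* j)

    -- Window swaps never open `o i` for a shifted `i`; these single swaps bring the missing gain
    -- `C* j - C j` to its clients. Different shifted facilities close different places, so each
    -- client is rerouted at most once.
    shifted-swaps : 0 ℕ.< p → ∑ (λ i → on (H? i) (- e i)) ≤ ∑ (λ j → weight j * shiftedChange j)
    shifted-swaps 0<p = ≤-trans (∑-mono {g = λ i → ∑ (λ j → weight j * q i j)} each)
      (≤-trans (≤-reflexive (∑-swap (λ i j → weight j * q i j)))
        (∑-mono λ j → ≤-trans (≤-reflexive (∑-* (weight j) (λ i → q i j))) (*-mono-≤ˡ (weight-nonneg j) (total j))))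
      where
      q : Fin k → Fin n → ℚ
      q i j = on (a j ≟ i) (on (H? i) (C* j - C j)) + on (H? i ×-dec h i ≟ b j) (2ℚ * C* j)
      each : ∀ i → on (H? i) (- e i) ≤ ∑ (λ j → weight j * q i j)
      each i with H? i
      ... | yes (int , _) = ≤-trans (single-swap 0<p int)
          (≤-reflexive (∑-cong λ j → cong (λ z → weight j * (on (a j ≟ i) (C* j - C j) + z)) (lem (h i ≟ b j))))
        where
        lem : ∀ {P v} (d : Dec P) → on d v ≡ on (yes (int , _) ×-dec d) v
        lem (yes _) = refl
        lem (no _) = refl
      ... | no _ = ≤-reflexive (sym (trans (∑-cong λ j → trans (cong (weight j *_) (lem (a j ≟ i)))
          (ℚ.*-zeroʳ (weight j))) (∑-zero n)))
        where
        lem : ∀ {P} (d : Dec P) → on d 0ℚ + 0ℚ ≡ 0ℚ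
        lem (yes _) = refl
        lem (no _) = refl
      total : ∀ j → ∑ (λ i → q i j) ≤ on (H? (a j)) (C* j - C j) + on (shiftInto? (b j)) (2ℚ * C* j)
      total j = ≤-trans (≤-reflexive (∑-+ (λ i → on (a j ≟ i) (on (H? i) (C* j - C j))) _))
        (+-mono-≤ (≤-reflexive (∑-select (a j) (λ i → on (H? i) (C* j - C j)))) (into (shiftInto? (b j))))
        where
        into : ∀ d → ∑ (λ i → on (H? i ×-dec h i ≟ b j) (2ℚ * C* j)) ≤ on d (2ℚ * C* j)
        into (yes _) = ∑-at-most-one (λ i → H? i ×-dec h i ≟ b j) (2C*≥0 j)
          (λ { ((int , _) , e) (_ , e′) → sym (only-child int (trans e′ (sym e))) })
        into (no none) = ≤-reflexive (trans (∑-cong λ i → on-no (H? i ×-dec h i ≟ b j) (λ r → none (i , r)))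
            (∑-zero k))

    module _ (ℓ′ φ : ℕ) (ℓ′<p : ℓ′ ℕ.< p) (φ≤ℓ′ : φ ℕ.≤ ℓ′) where

      open Windows ℓ′ φ

      -- The charge to a client over all windows of one phase: the gain occurs in the window of
      -- `a j`, a rerouting in the window of `b j` and in the only refill that shifts `b j`, and a
      -- stranding in the window that starts behind the cut at `a j`.
      windowChange : Fin n → ℚ
      windowChange j = on (¬? (H? (a j))) (C* j - C j)
        + (on (¬? (shiftInto? (b j))) (4ℚ * C* j) + on (cut? (a j)) (2ℚ * C* j + γ (a j)))

      private
        P : Fin k → Fin k → ℚ
        P y i = on (first i ≟ y) (saving i) - on (fill? y i) (2ℚ * f* i)

        rerouted : Fin k → Fin n → ℚ
        rerouted y j = on (¬? (shiftInto? (b j))) (on (first (b j) ≟ y) (2ℚ * C* j) + on (fill? y (b j)) (2ℚ * C* j))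

        strayed : Fin k → Fin n → ℚ
        strayed y j = on (first (h (a j)) ≟ y) (on (cut? (a j)) (2ℚ * C* j + γ (a j)))

        gained : Fin k → Fin n → ℚ
        gained y j = on (first (a j) ≟ y) (on (¬? (H? (a j))) (C* j - C j))

        Q : Fin k → Fin n → ℚ
        Q y j = gained y j + (rerouted y j + strayed y j)

        rerouted≥0 : ∀ y j → 0ℚ ≤ rerouted y j
        rerouted≥0 y j = on-nonneg (¬? (shiftInto? (b j)))
          (+≥0 (on-nonneg (first (b j) ≟ y) (2C*≥0 j)) (on-nonneg (fill? y (b j)) (2C*≥0 j)))

        strayed≥0 : ∀ y j → 0ℚ ≤ strayed y j
        strayed≥0 y j = on-nonneg (first (h (a j)) ≟ y) (on-nonneg (cut? (a j)) (+≥0 (2C*≥0 j) (γ≥0 (a j))))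

        s : Fin k → Fin k → Fin n
        s y i = if′ (take? y i) (o i) (σ (target y i))

        s-stay : ∀ {y i} → ¬ Take y i → s y i ≡ σ (target y i)
        s-stay {y} {i} ¬t = if-no (take? y i) ¬t

        s-shift : ∀ {y i} → Shift y i → s y i ≡ σ (h i)
        s-shift {y} {i} sh = trans (s-stay (shift⇒¬take sh)) (cong σ (if-yes (shift? y i) sh))

        shift-cost : ∀ i → c (loc i) (σ (h i)) ≤ f* i + e i
        shift-cost i = c-tri (loc i) (o i) (σ (h i))

        moves : ∀ y i → c (loc i) (s y i) + P y i ≤ f i
        moves y i = go (first i ≟ y) (fill? y i) (H? i)
          where
          go : (w : Dec (first i ≡ y)) (F : Dec (Fill y i)) (d : Dec (H i)) →
            c (loc i) (s y i) + (on w (f i - f* i - on d (e i)) - on F (2ℚ * f* i)) ≤ f i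
          go (yes q) (yes F) _ = contradiction q (proj₁ (proj₂ (proj₂ F)))
          go (yes q) (no _) (yes H-i) = ≤-trans
            (ℚ.+-monoˡ-≤ _ (subst (λ v → c (loc i) v ≤ f* i + e i) (sym (s-shift (inj₁ (q , H-i)))) (shift-cost i)))
            (≤-reflexive (solve 3 (λ f s e → s :+ e :+ (f :- s :- e :- con 0ℚ) := f) refl (f i) (f* i) (e i)))
          go (yes q) (no _) (no ¬H-i) = ≤-trans
            (≤-reflexive (cong (λ v → c (loc i) v + (f i - f* i - 0ℚ - 0ℚ)) (if-yes (take? y i) (q , ¬H-i))))
            (≤-reflexive (solve 2 (λ f s → s :+ (f :- s :- con 0ℚ :- con 0ℚ) := f) refl (f i) (f* i)))
          -- A refilling shift costs `f* i + e i`, and `e i ≤ f i + f* i`; this is the source of the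
          -- extra `2ℚ * f* i`.
          go (no q) (yes F) _ = ≤-trans
            (ℚ.+-monoˡ-≤ _ (subst (λ v → c (loc i) v ≤ f* i + (f i + f* i)) (sym (s-shift (inj₂ F)))
              (≤-trans (shift-cost i) (ℚ.+-monoʳ-≤ (f* i) (e≤f+f* i)))))
            (≤-reflexive (solve 2 (λ f s → s :+ (f :+ s) :+ (con 0ℚ :- con 2ℚ :* s) := f) refl (f i) (f* i)))
          go (no q) (no ¬F) _ = ≤-reflexive (trans
              (cong (λ v → c (loc i) v + (0ℚ - 0ℚ)) (trans (s-stay (λ t → q (proj₁ t)))
              (cong σ (if-no (shift? y i) λ { (inj₁ (r , _)) → q r ; (inj₂ F) → ¬F F })))) (ℚ.+-identityʳ (f i)))

        not-gained : ∀ {y j} → ¬ Take y (a j) → gained y j ≡ 0ℚ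
        not-gained {y} {j} ¬t with first (a j) ≟ y
        ... | no _ = refl
        ... | yes q = on-no (¬? (H? (a j))) (λ r → ¬t (q , r))

        -- A client uses `o (a j)` if that is opened, else its old place if that is open, else the
        -- place nearest to `o (a j)`. If this is closed too, `Closed.children` leaves only the case
        -- of a cut, and the client goes to `σ (a j)`.
        serves : ∀ y j → ∃ λ i → c j (s y i) ≤ C j + Q y j
        serves y j with take? y (a j)
        ... | yes t@(q , ¬H-a) = a j , ≤-trans (≤-reflexive (cong (c j) (if-yes (take? y (a j)) t)))
          (≤-by-diff (rerouted y j + strayed y j) (+≥0 (rerouted≥0 y j) (strayed≥0 y j))
            (trans (cong (λ z → C j + (z + (rerouted y j + strayed y j)))
                (trans (on-yes (first (a j) ≟ y) q) (on-yes (¬? (H? (a j))) ¬H-a)))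
              (solve 3 (λ s t q → t :+ (s :- t :+ q) := s :+ q) refl (C* j) (C j) (rerouted y j + strayed y j))))
        ... | no ¬t with open-or-closed y (b j) | open-or-closed y (h (a j))
        ...   | inj₁ (i , ¬t′ , e) | _ = i , ≤-trans (≤-reflexive (cong (c j) (trans (s-stay ¬t′) (cong σ e))))
          (≤-by-diff (rerouted y j + strayed y j) (+≥0 (rerouted≥0 y j) (strayed≥0 y j))
            (trans (cong (λ z → C j + (z + (rerouted y j + strayed y j))) (not-gained ¬t))
                (cong (C j +_) (ℚ.+-identityˡ _))))
        ...   | inj₂ cl | inj₁ (i , ¬t′ , e) = i , ≤-trans (≤-reflexive (cong (c j) (trans (s-stay ¬t′) (cong σ e))))
          (≤-trans (to-h j) (ℚ.+-monoʳ-≤ (C j) (≤-trans 2C*≤rerouted (≤-by-diff (strayed y j) (strayed≥0 y j)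
            (trans (cong (_+ (rerouted y j + strayed y j)) (not-gained ¬t)) (ℚ.+-identityˡ _))))))
          where
          2C*≤rerouted : 2ℚ * C* j ≤ rerouted y j
          2C*≤rerouted = ≤-trans (charged (Closed.where-is cl))
            (≤-reflexive (sym (on-yes (¬? (shiftInto? (b j))) (λ { (i′ , H-i , e) → Closed.no-shift cl e H-i }))))
            where
            charged : first (b j) ≡ y ⊎ Fill y (b j) → 2ℚ * C* j ≤ on (first (b j) ≟ y) (2ℚ * C* j) + on
                (fill? y (b j)) (2ℚ * C* j)
            charged (inj₁ q) = ≤-by-diff _ (on-nonneg (fill? y (b j)) (2C*≥0 j))
                (cong (_+ on (fill? y (b j)) (2ℚ * C* j)) (on-yes (first (b j) ≟ y) q))
            charged (inj₂ F) = ≤-by-diff _ (on-nonneg (first (b j) ≟ y) (2C*≥0 j))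
                (trans (cong (on (first (b j) ≟ y) (2ℚ * C* j) +_) (on-yes (fill? y (b j)) F))
                (ℚ.+-comm _ (2ℚ * C* j)))
        ...   | inj₂ _ | inj₂ cl with Closed.children cl refl
        ...     | inj₁ t = contradiction t ¬t
        ...     | inj₂ (cut-a , q , ¬t′ , e) = a j , ≤-trans
            (≤-reflexive (cong (c j) (trans (s-stay ¬t′) (cong σ e))))
          (≤-trans (to-a j) (ℚ.+-monoʳ-≤ (C j) (≤-by-diff (rerouted y j) (rerouted≥0 y j)
            (trans (cong₂ (λ z w → z + (rerouted y j + w)) (not-gained ¬t)
                (trans (on-yes (first (h (a j)) ≟ y) q) (on-yes (cut? (a j)) cut-a)))
              (trans (ℚ.+-identityˡ _) (ℚ.+-comm (rerouted y j) _))))))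

        each-window : ∀ y → ∑ (P y) ≤ ∑ (λ j → weight j * Q y j)
        each-window y = swap (s y) (take? y) colour (target y) (λ i → ℕ.<-≤-trans (ℕ.s≤s (colour-≤ φ≤ℓ′ i)) ℓ′<p)
          (λ { (q , ¬H-i) (q′ , ¬H-i′) e → colour-injective ¬H-i ¬H-i′ (trans q (sym q′)) e })
          s-stay target-injective (P y) (Q y) (moves y) (serves y)

        saved : ∀ i → saving i - 2ℚ * f* i ≤ ∑ (λ y → P y i)
        saved i = ≤-trans (ℚ.+-monoʳ-≤ (saving i)
            (ℚ.neg-antimono-≤ (∑-at-most-one (λ y → fill? y i) (*≥0 (ℕ→ℚ-nonneg 2) (f*≥0 i)) fill-unique)))
          (≤-reflexive (sym (trans (∑-- (λ y → on (first i ≟ y) (saving i)) (λ y → on (fill? y i) (2ℚ * f* i)))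
            (cong (_- ∑ (λ y → on (fill? y i) (2ℚ * f* i))) (∑-select (first i) (λ _ → saving i))))))

        paid : ∀ j → ∑ (λ y → Q y j) ≤ windowChange j
        paid j = ≤-trans (≤-reflexive (trans (∑-+ (λ y → gained y j) (λ y → rerouted y j + strayed y j)) (cong₂ _+_
            (∑-select (first (a j)) (λ _ → on (¬? (H? (a j))) (C* j - C j)))
                (∑-+ (λ y → rerouted y j) (λ y → strayed y j)))))
          (ℚ.+-monoʳ-≤ (on (¬? (H? (a j))) (C* j - C j)) (+-mono-≤ (rerouted-total (¬? (shiftInto? (b j))))
            (≤-reflexive (∑-select (first (h (a j))) (λ _ → on (cut? (a j)) (2ℚ * C* j + γ (a j)))))))
          where
          rerouted-total : ∀ {R : Set} (d : Dec R) → ∑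
              (λ y → on d (on (first (b j) ≟ y) (2ℚ * C* j) + on (fill? y (b j)) (2ℚ * C* j))) ≤ on d (4ℚ * C* j)
          rerouted-total (no _) = ≤-reflexive (∑-zero k)
          rerouted-total (yes _) = ≤-trans (≤-reflexive
              (∑-+ (λ y → on (first (b j) ≟ y) (2ℚ * C* j)) (λ y → on (fill? y (b j)) (2ℚ * C* j))))
            (≤-trans (+-mono-≤ (≤-reflexive (∑-select (first (b j)) (λ _ → 2ℚ * C* j)))
                (∑-at-most-one (λ y → fill? y (b j)) (2C*≥0 j) fill-unique))
              (≤-reflexive (solve 1 (λ s → con 2ℚ :* s :+ con 2ℚ :* s := con 4ℚ :* s) refl (C* j))))

      window-swaps : ∑ (λ i → saving i - 2ℚ * f* i) ≤ ∑ (λ j → weight j * windowChange j)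
      window-swaps = ≤-trans (∑-mono saved) (≤-trans (≤-reflexive (sym (∑-swap P)))
        (≤-trans (∑-mono each-window) (≤-trans (≤-reflexive (∑-swap (λ y j → weight j * Q y j)))
          (∑-mono λ j → ≤-trans (≤-reflexive (∑-* (weight j) (λ y → Q y j)))
              (*-mono-≤ˡ (weight-nonneg j) (paid j))))))

      -- Every client gains `C* j - C j` once, in the windows or in the single swaps. Its place
      -- costs it `4ℚ * C* j` in the windows or, if some facility is shifted into that place,
      -- `2ℚ * C* j` in the single swaps. A shifted facility pays `e i` in both.
      combined : ∑ (λ i → f i - ℕ→ℚ 3 * f* i - 2ℚ * on (H? i) (e i)) ≤
        ∑ (λ j → weight j * (ℕ→ℚ 5 * C* j - C j + on (cut? (a j)) (2ℚ * C* j + γ (a j))))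
      combined = ≤-trans (≤-reflexive (trans (∑-cong split)
          (∑-+ (λ i → saving i - 2ℚ * f* i) (λ i → on (H? i) (- e i)))))
        (≤-trans (+-mono-≤ window-swaps (shifted-swaps (ℕ.≤-<-trans ℕ.z≤n ℓ′<p)))
          (≤-trans (≤-reflexive (sym (∑-+ (λ j → weight j * windowChange j) (λ j → weight j * shiftedChange j))))
            (∑-mono λ j → ≤-trans (≤-reflexive (sym (ℚ.*-distribˡ-+ (weight j) (windowChange j) (shiftedChange j))))
            (*-mono-≤ˡ (weight-nonneg j) (merge j (H? (a j)) (shiftInto? (b j)))))))
        where
        on-neg : ∀ {R : Set} (r : Dec R) v → on r (- v) ≡ - on r v
        on-neg (yes _) v = refl
        on-neg (no _) v = refl
        split : ∀ i → f i - ℕ→ℚ 3 * f* i - 2ℚ * on (H? i) (e i) ≡ saving i - 2ℚ * f* i + on (H? i) (- e i)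
        split i = trans (solve 3 (λ f s e → f :- con (ℕ→ℚ 3) :* s :- con 2ℚ :* e := f :- s :- e :- con 2ℚ :* s :+
            (:- e)) refl
          (f i) (f* i) (on (H? i) (e i))) (cong (saving i - 2ℚ * f* i +_) (sym (on-neg (H? i) (e i))))
        merge : ∀ j (u : Dec (H (a j))) (v : Dec (ShiftInto (b j))) →
          on (¬? u) (C* j - C j) + (on (¬? v) (4ℚ * C* j) + on (cut? (a j)) (2ℚ * C* j + γ (a j)))
            + (on u (C* j - C j) + on v (2ℚ * C* j))
          ≤ ℕ→ℚ 5 * C* j - C j + on (cut? (a j)) (2ℚ * C* j + γ (a j))
        merge j u v = ≤-trans (≤-reflexive (solve 5
            (λ w x y z t → w :+ (x :+ y) :+ (z :+ t) := (w :+ z) :+ (x :+ t) :+ y) refl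
            (on (¬? u) (C* j - C j)) (on (¬? v) (4ℚ * C* j)) (on (cut? (a j)) (2ℚ * C* j + γ (a j)))
                (on u (C* j - C j)) (on v (2ℚ * C* j))))
          (ℚ.+-monoˡ-≤ _ (≤-trans (+-mono-≤ (≤-reflexive (whole u)) (four v))
            (≤-reflexive (solve 2 (λ s t → s :- t :+ con 4ℚ :* s := con (ℕ→ℚ 5) :* s :- t) refl (C* j) (C j)))))
          where
          whole : ∀ {R : Set} (r : Dec R) {q} → on (¬? r) q + on r q ≡ q
          whole (yes _) = ℚ.+-identityˡ _
          whole (no _) = ℚ.+-identityʳ _
          four : ∀ {R : Set} (r : Dec R) → on (¬? r) (4ℚ * C* j) + on r (2ℚ * C* j) ≤ 4ℚ * C* j
          four (no _) = ≤-reflexive (ℚ.+-identityʳ _)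
          four (yes _) = ≤-by-diff (2ℚ * C* j) (2C*≥0 j)
            (solve 1 (λ s → con 4ℚ :* s := con 0ℚ :+ con 2ℚ :* s :+ con 2ℚ :* s) refl (C* j))

  -- Totals, the constant-factor bound and the average over phases.

  F F* SC SC* : ℚ
  F = moveCost I σ
  F* = moveCost I o
  SC = serviceCost σ b
  SC* = serviceCost o a

  scaled : ∀ r → ∑ (λ j → weight j * (r * C* j)) ≡ r * SC*
  scaled r = trans (∑-cong λ j → solve 3 (λ w r s → w :* (r :* s) := r :* (w :* s)) refl (weight j) r (C* j))
    (∑-* r (λ j → weight j * C* j))

  module Total (L : Paths h) (saturated : Saturated h L) (good : Fin k → Bool) where

    open Scheme L saturated good public

    shifted : ℚ
    shifted = ∑ (λ i → on (H? i) (e i))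

    module _ (ℓ′ φ : ℕ) where
      open Windows ℓ′ φ using (cut?)
      strayed : ℚ
      strayed = ∑ (λ j → weight j * on (cut? (a j)) (2ℚ * C* j + γ (a j)))

    total : ∀ ℓ′ φ → ℓ′ ℕ.< p → φ ℕ.≤ ℓ′ → F + SC ≤ ℕ→ℚ 3 * F* + ℕ→ℚ 5 * SC* + 2ℚ * shifted + strayed ℓ′ φ
    total ℓ′ φ ℓ′<p φ≤ℓ′ = ≤-by-diff _ (diff≥0 (combined ℓ′ φ ℓ′<p φ≤ℓ′))
      (trans (solve 6 (λ F F* SC SC* E K → con (ℕ→ℚ 3) :* F* :+ con (ℕ→ℚ 5) :* SC* :+ con 2ℚ :* E :+ K
          := F :+ SC :+ (con (ℕ→ℚ 5) :* SC* :- SC :+ K :- (F :- con (ℕ→ℚ 3) :* F* :- con 2ℚ :* E))) refl F F* SC SC*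
              shifted (strayed ℓ′ φ))
        (cong₂ (λ u v → F + SC + (u - v)) (sym right) (sym left)))
      where
      open Windows ℓ′ φ using (cut?)
      left : ∑ (λ i → f i - ℕ→ℚ 3 * f* i - 2ℚ * on (H? i) (e i)) ≡ F - ℕ→ℚ 3 * F* - 2ℚ * shifted
      left = trans (∑-- (λ i → f i - ℕ→ℚ 3 * f* i) (λ i → 2ℚ * on (H? i) (e i))) (cong₂ _-_
        (trans (∑-- f (λ i → ℕ→ℚ 3 * f* i)) (cong (λ z → F - z) (∑-* (ℕ→ℚ 3) f*))) (∑-* 2ℚ (λ i → on (H? i) (e i))))
      right : ∑ (λ j → weight j * (ℕ→ℚ 5 * C* j - C j + on (cut? (a j)) (2ℚ * C* j + γ (a j)))) ≡ ℕ→ℚ 5 * SC* - SC +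
          strayed ℓ′ φ
      right = trans (∑-cong λ j → solve 4 (λ w s t q → w :* (s :- t :+ q) := w :* s :- w :* t :+ w :* q) refl
          (weight j) (ℕ→ℚ 5 * C* j) (C j) (on (cut? (a j)) (2ℚ * C* j + γ (a j))))
        (trans (∑-+ (λ j → weight j * (ℕ→ℚ 5 * C* j) - weight j * C j)
            (λ j → weight j * on (cut? (a j)) (2ℚ * C* j + γ (a j))))
          (cong (_+ strayed ℓ′ φ) (trans (∑-- (λ j → weight j * (ℕ→ℚ 5 * C* j)) (λ j → weight j * C j))
              (cong (_- SC) (scaled (ℕ→ℚ 5))))))

  -- Shift every facility along the paths, moving only the last one of each segment.
  γ-total : 0 ℕ.< p → ∑ γ ≤ 4ℚ * F* + ℕ→ℚ 5 * SC*
  γ-total 0<p = ≤-by-diff _ (+≥0 (diff≥0 lower) (+≥0 (diff≥0 (window-swaps 0 0 0<p ℕ.≤-refl)) (diff≥0 upper)))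
    (solve 5 (λ g s u v w → v :+ w := g :+ (s :- (g :- v) :+ (u :- s :+ (w :- u)))) refl
      (∑ γ) (∑ (λ i → saving i - 2ℚ * f* i)) (∑ (λ j → weight j * windowChange 0 0 0<p ℕ.≤-refl j)) (4ℚ * F*)
          (ℕ→ℚ 5 * SC*))
    where
    open Scheme (proj₁ (saturate h)) (proj₂ (saturate h)) (λ _ → false)
    open Windows 0 0 using (cut?)
    -- Since `on (H? i) (e i)` is at most `e i`, the saving net of refills is at least
    -- `f i - f* i - e i - 2ℚ * f* i`, which is `γ i - 4ℚ * f* i`.
    lower : ∑ γ - 4ℚ * F* ≤ ∑ (λ i → saving i - 2ℚ * f* i)
    lower = ≤-trans (≤-reflexive (sym (trans (∑-- γ (λ i → 4ℚ * f* i)) (cong (λ z → ∑ γ - z) (∑-* 4ℚ f*)))))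
      (∑-mono λ i → ≤-by-diff (e i - on (H? i) (e i)) (diff≥0 (on-≤ (H? i) (e≥0 i)))
        (solve 4 (λ f s e u → f :- s :- u :- con 2ℚ :* s := f :+ s :- e :- con 4ℚ :* s :+ (e :- u)) refl (f i) (f* i)
            (e i) (on (H? i) (e i))))
    upper : ∑ (λ j → weight j * windowChange 0 0 0<p ℕ.≤-refl j) ≤ ℕ→ℚ 5 * SC*
    upper = ≤-trans (∑-mono λ j → *-mono-≤ˡ (weight-nonneg j) (change j)) (≤-reflexive (scaled (ℕ→ℚ 5)))
      where
      gain : ∀ j {R : Set} (d : Dec R) → on d (C* j - C j) ≤ C* j
      gain j (yes _) = ≤-by-diff (C j) (C≥0 j) (solve 2 (λ s t → s := s :- t :+ t) refl (C* j) (C j))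
      gain j (no _) = C*≥0 j
      change : ∀ j → windowChange 0 0 0<p ℕ.≤-refl j ≤ ℕ→ℚ 5 * C* j
      change j = ≤-trans (+-mono-≤ (gain j (¬? (H? (a j)))) (+-mono-≤
          (on-≤ (¬? (shiftInto? (b j))) (*≥0 (ℕ→ℚ-nonneg 4) (C*≥0 j)))
              (≤-reflexive (on-no (cut? (a j)) λ { (_ , () , _) }))))
        (≤-reflexive (solve 1 (λ s → s :+ (con 4ℚ :* s :+ con 0ℚ) := con (ℕ→ℚ 5) :* s) refl (C* j)))

  -- An arc i is good if e i is not much smaller than the distance of σ i to o i.
  module Threshold (m : ℕ) where

    good : Fin k → Bool
    good i = does (f i + f* i ℚ.≤? ℕ→ℚ m * e i)

    good-≤ : ∀ {i} → good i ≡ true → f i + f* i ≤ ℕ→ℚ m * e i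
    good-≤ {i} = go (f i + f* i ℚ.≤? ℕ→ℚ m * e i)
      where
      go : ∀ {R : Set} (d : Dec R) → does d ≡ true → R
      go (yes r) _ = r

    bad-≥ : ∀ {i} → good i ≡ false → ℕ→ℚ m * e i ≤ f i + f* i
    bad-≥ {i} g = ℚ.<⇒≤ (ℚ.≰⇒> (go (f i + f* i ℚ.≤? ℕ→ℚ m * e i) g))
      where
      go : ∀ {R : Set} (d : Dec R) → does d ≡ false → ¬ R
      go (no ¬r) _ = ¬r

    open Total (proj₁ (saturate h)) (proj₂ (saturate h)) good public

  -- The error terms `2ℚ * shifted + strayed 0 0` are at most `6 SC* + 3 ∑ γ`, and `γ-total` bounds
  -- `∑ γ` without `F` and `SC`. Together this is `15 F* + 26 SC*`.
  constant-factor : 0 ℕ.< p → F + SC ≤ ℕ→ℚ 26 * (F* + SC*)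
  constant-factor 0<p = ≤-by-diff _
    (+≥0 (diff≥0 (total 0 0 0<p ℕ.≤-refl)) (+≥0 (*≥0 (ℕ→ℚ-nonneg 2) (diff≥0 shifted-≤)) (+≥0 (diff≥0 strayed-≤)
      (+≥0 (*≥0 (ℕ→ℚ-nonneg 3) (diff≥0 (γ-total 0<p))) (*≥0 (ℕ→ℚ-nonneg 11) (∑-nonneg f*≥0))))))
    (solve 6 (λ F F* SC* E K g → con (ℕ→ℚ 26) :* (F* :+ SC*) := F :+
        (con (ℕ→ℚ 3) :* F* :+ con (ℕ→ℚ 5) :* SC* :+ con 2ℚ :* E :+ K :- F
        :+ (con 2ℚ :* (g :- E) :+ (con (ℕ→ℚ 6) :* SC* :+ g :- K
        :+ (con (ℕ→ℚ 3) :* (con 4ℚ :* F* :+ con (ℕ→ℚ 5) :* SC* :- g) :+ con (ℕ→ℚ 11) :* F*))))) refl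
      (F + SC) F* SC* shifted (strayed 0 0) (∑ γ))
    where
    open Threshold 2
    open Windows 0 0 using (Cut; cut?)

    shifted-≤ : shifted ≤ ∑ γ
    shifted-≤ = ∑-mono λ i → ≤-trans (on-mono (H? i) λ { (_ , g) → ≤-by-diff _ (diff≥0 (bad-≥ g))
        (solve 3 (λ f s e → f :+ s :- e := e :+ (f :+ s :- con 2ℚ :* e)) refl (f i) (f* i) (e i)) })
      (on-≤ (H? i) (γ≥0 i))

    demand : Fin k → ℚ
    demand i = ∑ (λ j → weight j * on (a j ≟ i) 1ℚ)

    q : Fin k → Fin n → ℚ
    q i j = on (a j ≟ i) (2ℚ * C* j) + on (h i ≟ b j) (2ℚ * C* j)

    slack : Fin k → ℚ
    slack i = ∑ (λ j → weight j * q i j)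

    slack≥0 : ∀ i → 0ℚ ≤ slack i
    slack≥0 i = ∑-nonneg λ j → *≥0 (weight-nonneg j)
        (+≥0 (on-nonneg (a j ≟ i) (2C*≥0 j)) (on-nonneg (h i ≟ b j) (2C*≥0 j)))

    -- In the single swap for `i` each client of `o i` changes by at most `2ℚ * C* j - e i`, because
    -- `e i ≤ C* j + C j`. Large demand at `o i` would therefore make the swap profitable.
    demand-e : ∀ {i} → Internal i → demand i * e i ≤ e i + slack i
    demand-e {i} int = ≤-by-diff _ (+≥0 (diff≥0 (single-swap 0<p int)) (diff≥0 clients))
      (solve 4 (λ Λe e K u → e :+ K := Λe :+ (u :- (:- e) :+ (K :- u :- Λe))) refl (demand i * e i) (e i) (slack i)
        (∑ (λ j → weight j * change j)))
      where
      change : Fin n → ℚ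
      change j = on (a j ≟ i) (C* j - C j) + on (h i ≟ b j) (2ℚ * C* j)
      clients : demand i * e i ≤ slack i - ∑ (λ j → weight j * change j)
      clients = ≤-trans (≤-reflexive (trans (ℚ.*-comm (demand i) (e i))
          (sym (∑-* (e i) (λ j → weight j * on (a j ≟ i) 1ℚ)))))
        (≤-trans (∑-mono client) (≤-reflexive (∑-- (λ j → weight j * q i j) (λ j → weight j * change j))))
        where
        client : ∀ j → e i * (weight j * on (a j ≟ i) 1ℚ) ≤ weight j * q i j - weight j * change j
        client j with a j ≟ i
        ... | yes refl = ≤-by-diff _ (*≥0 (weight-nonneg j) (diff≥0 (e≤C*+C j)))
          (solve 5 (λ w e s t u → w :* (con 2ℚ :* s :+ u) :- w :* (s :- t :+ u) := e :* (w :* con 1ℚ) :+ w :*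
              (s :+ t :- e)) refl
            (weight j) (e (a j)) (C* j) (C j) (on (h (a j) ≟ b j) (2ℚ * C* j)))
        ... | no _ = ≤-reflexive (solve 3 (λ w e u → e :* (w :* con 0ℚ) := w :* (con 0ℚ :+ u) :- w :* (con 0ℚ :+ u))
            refl
            (weight j) (e i) (on (h i ≟ b j) (2ℚ * C* j)))

    demand-γ : ∀ {i} → Cut i → demand i * γ i ≤ γ i + slack i
    demand-γ {i} (int , g , _) = scale-down {demand i} (γ≥0 i) (≤-by-diff _ (diff≥0 (good-≤ g))
        (solve 3 (λ f s e → e := f :+ s :- e :+ (con 2ℚ :* e :- (f :+ s))) refl (f i) (f* i) (e i)))
      (slack≥0 i) (demand-e int)

    strayed-≤ : strayed 0 0 ≤ ℕ→ℚ 6 * SC* + ∑ γ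
    strayed-≤ = ≤-trans (∑-mono λ j → ≤-trans (*-mono-≤ˡ (weight-nonneg j) (split j))
        (≤-reflexive (ℚ.*-distribˡ-+ (weight j) (2ℚ * C* j) (on (cut? (a j)) (γ (a j))))))
      (≤-trans (≤-reflexive (trans (∑-+ (λ j → weight j * (2ℚ * C* j)) (λ j → weight j * on (cut? (a j)) (γ (a j))))
        (cong₂ _+_ (scaled 2ℚ) by-arc)))
      (≤-trans (ℚ.+-monoʳ-≤ (2ℚ * SC*) (≤-trans (∑-mono arc)
          (≤-trans (≤-reflexive (∑-+ γ (λ i → on (cut? i) (slack i)))) (ℚ.+-monoʳ-≤ (∑ γ) slack-total))))
        (≤-reflexive (solve 2 (λ s g → con 2ℚ :* s :+ (g :+ con 4ℚ :* s) := con (ℕ→ℚ 6) :* s :+ g) refl SC* (∑ γ)))))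
      where
      split : ∀ j → on (cut? (a j)) (2ℚ * C* j + γ (a j)) ≤ 2ℚ * C* j + on (cut? (a j)) (γ (a j))
      split j with cut? (a j)
      ... | yes _ = ≤-refl
      ... | no _ = +≥0 (2C*≥0 j) ≤-refl
      by-arc : ∑ (λ j → weight j * on (cut? (a j)) (γ (a j))) ≡ ∑ (λ i → on (cut? i) (demand i * γ i))
      by-arc = trans (∑-cong λ j → trans (cong (weight j *_) (sym (∑-select (a j) (λ i → on (cut? i) (γ i)))))
          (sym (∑-* (weight j) (λ i → on (a j ≟ i) (on (cut? i) (γ i))))))
        (trans (∑-swap (λ j i → weight j * on (a j ≟ i) (on (cut? i) (γ i)))) (∑-cong λ i → arcwise i (cut? i)))
        where
        arcwise : ∀ i {R : Set} (d : Dec R) → ∑ (λ j → weight j * on (a j ≟ i) (on d (γ i))) ≡ on d (demand i * γ i)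
        arcwise i (yes _) = trans (∑-cong λ j → unit j (a j ≟ i))
            (trans (∑-* (γ i) (λ j → weight j * on (a j ≟ i) 1ℚ)) (ℚ.*-comm (γ i) (demand i)))
          where
          unit : ∀ j {R : Set} (d : Dec R) → weight j * on d (γ i) ≡ γ i * (weight j * on d 1ℚ)
          unit j (yes _) = solve 2 (λ w g → w :* g := g :* (w :* con 1ℚ)) refl (weight j) (γ i)
          unit j (no _) = solve 2 (λ w g → w :* con 0ℚ := g :* (w :* con 0ℚ)) refl (weight j) (γ i)
        arcwise i (no _) = trans (∑-cong λ j → trans (cong (weight j *_) (none (a j ≟ i))) (ℚ.*-zeroʳ (weight j)))
            (∑-zero n)
          where
          none : ∀ {R : Set} (d : Dec R) → on d 0ℚ ≡ 0ℚ
          none (yes _) = refl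
          none (no _) = refl
      arc : ∀ i → on (cut? i) (demand i * γ i) ≤ γ i + on (cut? i) (slack i)
      arc i with cut? i
      ... | yes C-i = demand-γ C-i
      ... | no _ = +≥0 (γ≥0 i) ≤-refl
      slack-total : ∑ (λ i → on (cut? i) (slack i)) ≤ 4ℚ * SC*
      slack-total = ≤-trans (≤-reflexive (trans (∑-cong λ i → inside i (cut? i))
          (∑-swap (λ i j → weight j * on (cut? i) (q i j)))))
        (≤-trans (∑-mono λ j → ≤-trans (≤-reflexive (∑-* (weight j) (λ i → on (cut? i) (q i j))))
            (*-mono-≤ˡ (weight-nonneg j) (twice j)))
          (≤-reflexive (scaled 4ℚ)))
        where
        inside : ∀ i {R : Set} (d : Dec R) → on d (slack i) ≡ ∑ (λ j → weight j * on d (q i j))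
        inside i (yes _) = refl
        inside i (no _) = sym (trans (∑-cong λ j → ℚ.*-zeroʳ (weight j)) (∑-zero n))
        -- A client enters `q i j` for `i ≡ a j` and for the at most one internal `i` with
        -- `h i ≡ b j`.
        twice : ∀ j → ∑ (λ i → on (cut? i) (q i j)) ≤ 4ℚ * C* j
        twice j = ≤-trans (∑-mono λ i → each i (cut? i))
            (≤-trans (≤-reflexive (∑-+ (λ i → on (a j ≟ i) (2ℚ * C* j))
            (λ i → on (cut? i ×-dec h i ≟ b j) (2ℚ * C* j))))
          (≤-trans (+-mono-≤ (≤-reflexive (∑-select (a j) (λ _ → 2ℚ * C* j)))
              (∑-at-most-one (λ i → cut? i ×-dec h i ≟ b j) (2C*≥0 j)
                  λ { ((int , _) , r) (_ , r′) → sym (only-child int (trans r′ (sym r))) }))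
            (≤-reflexive (solve 1 (λ s → con 2ℚ :* s :+ con 2ℚ :* s := con 4ℚ :* s) refl (C* j)))))
          where
          each : ∀ i (d : Dec (Cut i)) → on d (q i j) ≤ on (a j ≟ i) (2ℚ * C* j) + on (d ×-dec h i ≟ b j) (2ℚ * C* j)
          each i (yes _) with h i ≟ b j
          ... | yes _ = ≤-refl
          ... | no _ = ≤-refl
          each i (no _) = +≥0 (on-nonneg (a j ≟ i) (2C*≥0 j)) ≤-refl

  -- `total` is summed over `m * m` phases. `shifted` is at most a fraction `1/m` of `F + F*`, and a
  -- client is stranded in at most one phase, at a cost of at most `m + 2` times `C j + C* j`. As
  -- `m + 2 ≤ 3 m`, the relative error is `3/m`.
  averaged : ∀ {m} → 0 ℕ.< m → m ℕ.* m ℕ.≤ p →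
    ℕ→ℚ m * (F + SC) ≤ ℕ→ℚ m * (ℕ→ℚ 3 * F* + ℕ→ℚ 5 * SC*) + ℕ→ℚ 3 * (F + F* + (SC + SC*))
  averaged {m@(suc m-1)} 0<m m²≤p = *-cancel-≤ {ℕ→ℚ m} 0<M (≤-by-diff _
    (+≥0 (diff≥0 sum-φ) (+≥0 (*≥0 (*≥0 (ℕ→ℚ-nonneg 2) M≥0) (diff≥0 shifted-≤))
        (+≥0 (*≥0 M≥0 (+≥0 F≥0 F*≥0)) (*≥0 (*≥0 (ℕ→ℚ-nonneg 2) (diff≥0 1≤M)) (+≥0 SC≥0 SC*≥0)))))
    (solve 6 (λ M F F* SC SC* E →
      M :* (M :* (con (ℕ→ℚ 3) :* F* :+ con (ℕ→ℚ 5) :* SC*) :+ con (ℕ→ℚ 3) :* (F :+ F* :+ (SC :+ SC*))) :=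
      M :* (M :* (F :+ SC)) :+ (M :* M :* (con (ℕ→ℚ 3) :* F* :+ con (ℕ→ℚ 5) :* SC* :+ con 2ℚ :* E) :+ (M :+ con 2ℚ)
          :* (SC :+ SC*) :- M :* M :* (F :+ SC)
       :+ (con 2ℚ :* M :* (F :+ F* :- M :* E) :+ (M :* (F :+ F*) :+ con 2ℚ :* (M :- con 1ℚ) :* (SC :+ SC*))))) refl
      M F F* SC SC* shifted))
    where
    open Threshold m
    M : ℚ
    M = ℕ→ℚ m
    1≤M : 1ℚ ≤ M
    1≤M = ℕ→ℚ-mono-≤ 0<m
    0<M : 0ℚ < M
    0<M = ℚ.<-≤-trans (ℚ.positive⁻¹ 1ℚ) 1≤M
    M≥0 : 0ℚ ≤ M
    M≥0 = ℕ→ℚ-nonneg m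
    F≥0 : 0ℚ ≤ F
    F≥0 = ∑-nonneg λ i → c-nonneg (loc i) (σ i)
    F*≥0 : 0ℚ ≤ F*
    F*≥0 = ∑-nonneg f*≥0
    SC≥0 : 0ℚ ≤ SC
    SC≥0 = ∑-nonneg λ j → *≥0 (weight-nonneg j) (C≥0 j)
    SC*≥0 : 0ℚ ≤ SC*
    SC*≥0 = ∑-nonneg λ j → *≥0 (weight-nonneg j) (C*≥0 j)
    -- Chosen so that `suc ℓ′` computes to `m * m`, the number both of phases and of colours.
    ℓ′ : ℕ
    ℓ′ = m-1 ℕ.+ m-1 ℕ.* m

    shifted-≤ : M * shifted ≤ F + F*
    shifted-≤ = ≤-trans (≤-reflexive (sym (∑-* M (λ i → on (H? i) (e i)))))
      (≤-trans (∑-mono λ i → each i (H? i)) (≤-reflexive (∑-+ f f*)))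
      where
      each : ∀ i (d : Dec (H i)) → M * on d (e i) ≤ f i + f* i
      each i (yes (_ , g)) = bad-≥ g
      each i (no _) = ≤-trans (≤-reflexive (ℚ.*-zeroʳ M)) (+≥0 (c-nonneg (loc i) (σ i)) (f*≥0 i))

    strayed-≤ : ∑ {suc ℓ′} (λ φ → strayed ℓ′ (toℕ φ)) ≤ (M + 2ℚ) * (SC + SC*)
    strayed-≤ = ≤-trans (≤-reflexive (∑-swap (λ φ j → weight j * on (Windows.cut? ℓ′ (toℕ {suc ℓ′} φ) (a j))
        (2ℚ * C* j + γ (a j)))))
      (≤-trans (∑-mono λ j → ≤-trans (≤-reflexive
          (∑-* (weight j) (λ φ → on (Windows.cut? ℓ′ (toℕ {suc ℓ′} φ) (a j)) (2ℚ * C* j + γ (a j)))))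
          (*-mono-≤ˡ (weight-nonneg j) (client j)))
        (≤-reflexive (trans (∑-cong λ j → solve 4 (λ w r s t → w :* (r :* (s :+ t)) := r :* (w :* s :+ w :* t)) refl
            (weight j) (M + 2ℚ) (C j) (C* j))
          (trans (∑-* (M + 2ℚ) (λ j → weight j * C j + weight j * C* j))
              (cong ((M + 2ℚ) *_) (∑-+ (λ j → weight j * C j) (λ j → weight j * C* j)))))))
      where
      client : ∀ j → ∑ {suc ℓ′} (λ φ → on (Windows.cut? ℓ′ (toℕ φ) (a j)) (2ℚ * C* j + γ (a j))) ≤ (M + 2ℚ) *
          (C j + C* j)
      client j = ≤-trans (∑-mono {suc ℓ′} λ φ → on-mono (Windows.cut? ℓ′ (toℕ φ) (a j)) λ { (_ , g , _) → bound g })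
        (∑-at-most-one {suc ℓ′} (λ φ → Windows.cut? ℓ′ (toℕ φ) (a j))
            (*≥0 (+≥0 M≥0 (ℕ→ℚ-nonneg 2)) (+≥0 (C≥0 j) (C*≥0 j)))
          λ u v → toℕ-injective (cut-phase ℓ′ u v))
        where
        -- For a good arc, `γ ≤ f + f* ≤ M * e`, and `e (a j) ≤ C* j + C j`.
        bound : good (a j) ≡ true → 2ℚ * C* j + γ (a j) ≤ (M + 2ℚ) * (C j + C* j)
        bound g = ≤-by-diff _ (+≥0 (diff≥0 (good-≤ g))
            (+≥0 (*≥0 M≥0 (diff≥0 (e≤C*+C j))) (+≥0 (e≥0 (a j)) (*≥0 (ℕ→ℚ-nonneg 2) (C≥0 j)))))
          (solve 6 (λ M s t f f* e → (M :+ con 2ℚ) :* (t :+ s) := con 2ℚ :* s :+ (f :+ f* :- e) :+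
            (M :* e :- (f :+ f*) :+ (M :* (s :+ t :- e) :+ (e :+ con 2ℚ :* t)))) refl M (C* j) (C j) (f (a j))
                (f* (a j)) (e (a j)))

    sum-φ : M * M * (F + SC) ≤ M * M * (ℕ→ℚ 3 * F* + ℕ→ℚ 5 * SC* + 2ℚ * shifted) + (M + 2ℚ) * (SC + SC*)
    sum-φ = ≤-trans (≤-reflexive (trans (cong (_* (F + SC)) (sym (ℕ→ℚ-* m m))) (sym (∑-const (suc ℓ′) (F + SC)))))
      (≤-trans (∑-mono {suc ℓ′} λ φ → total ℓ′ (toℕ φ) m²≤p (ℕ.≤-pred (toℕ<n φ)))
        (≤-trans (≤-reflexive (∑-+ {suc ℓ′} (λ _ → ℕ→ℚ 3 * F* + ℕ→ℚ 5 * SC* + 2ℚ * shifted)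
            (λ φ → strayed ℓ′ (toℕ φ))))
          (+-mono-≤ (≤-reflexive (trans (∑-const (suc ℓ′) (ℕ→ℚ 3 * F* + ℕ→ℚ 5 * SC* + 2ℚ * shifted))
              (cong (_* (ℕ→ℚ 3 * F* + ℕ→ℚ 5 * SC* + 2ℚ * shifted)) (ℕ→ℚ-* m m)))) strayed-≤)))

-- Choice of `m` and the final estimate.

-- The upper bound on `p` makes `1/m` at most twice the inverse cube root of `p`; the lower bound is
-- what `averaged` requires.
root : ∀ p → 1 ℕ.≤ p → ∃ λ m → 0 ℕ.< m × m ℕ.* m ℕ.≤ p × p ℕ.≤ (m ℕ.+ m) ℕ.* (m ℕ.+ m) ℕ.* (m ℕ.+ m)
root (suc zero) _ = 1 , ℕ.s≤s ℕ.z≤n , ℕ.≤-refl , ℕ.s≤s ℕ.z≤n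
root (suc p@(suc _)) _ with root p (ℕ.s≤s ℕ.z≤n)
... | m@(suc _) , 0<m , m²≤p , p≤ with suc p ℕ.≤? (m ℕ.+ m) ℕ.* (m ℕ.+ m) ℕ.* (m ℕ.+ m)
...   | yes q = m , 0<m , ℕ.m≤n⇒m≤1+n m²≤p , q
-- `m` is raised only when `suc p` exceeds `(2m)³`; then `(m + 1)² ≤ (2m)² ≤ (2m)³ < suc p`.
...   | no q = suc m , ℕ.s≤s ℕ.z≤n , ≤₁ , ≤₂
  where
  cube : ℕ → ℕ
  cube m = (m ℕ.+ m) ℕ.* (m ℕ.+ m) ℕ.* (m ℕ.+ m)
  ≤₁ : suc m ℕ.* suc m ℕ.≤ suc p
  ≤₁ = ℕ.≤-trans (ℕ.*-mono-≤ (ℕ.+-monoˡ-≤ m 0<m) (ℕ.+-monoˡ-≤ m 0<m))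
    (ℕ.≤-trans (ℕ.m≤m*n ((m ℕ.+ m) ℕ.* (m ℕ.+ m)) (m ℕ.+ m)) (ℕ.<⇒≤ (ℕ.≰⇒> q)))
  bigger : m ℕ.+ m ℕ.< suc m ℕ.+ suc m
  bigger = ℕ.+-mono-< (ℕ.n<1+n m) (ℕ.n<1+n m)
  ≤₂ : suc p ℕ.≤ cube (suc m)
  ≤₂ = ℕ.≤-<-trans p≤ (ℕ.*-mono-< (ℕ.*-mono-< bigger bigger) bigger)

1≤u³⇒1≤u : ∀ {u} → 0ℚ ≤ u → 1ℚ ≤ u * u * u → 1ℚ ≤ u
1≤u³⇒1≤u {u} 0≤u 1≤u³ with 1ℚ ℚ.≤? u
... | yes q = q
... | no q = ≤-trans 1≤u³ (≤-by-diff _ (+≥0 (*≥0 (*≥0 0≤u 0≤u) 0≤1-u) (*≥0 0≤u 0≤1-u))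
  (solve 1 (λ u → u := u :* u :* u :+ (u :* u :* (con 1ℚ :- u) :+ u :* (con 1ℚ :- u))) refl u))
  where
  0≤1-u : 0ℚ ≤ 1ℚ - u
  0≤1-u = diff≥0 (ℚ.<⇒≤ (ℚ.≰⇒> q))

-- The number `t` is any positive rational that is at least the inverse cube root of `p`, which
-- itself may be irrational; `A` is chosen before the instance and `p`.
theorem3p1 : ∃[ A ] (∀ (I : Instance) (p : ℕ) → 1 ℕ.≤ p
    → (S : Subset (Instance.n I)) → ∣ S ∣ ≡ Instance.k I
    → (∀ (S' : Subset (Instance.n I)) → ∣ S' ∣ ≡ Instance.k I
    → ∣ S ─ S' ∣ ≡ ∣ S' ─ S ∣ → ∣ S ─ S' ∣ ℕ.≤ p
    → ∀ x x' → IsCostOfSet I S x → IsCostOfSet I S' x' → x ≤ x')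
    → ∀ x → IsCostOfSet I S x
    → ∀ s F* C* → IsOptimal I s F* C*
    → ∀ (t : ℚ) → 0ℚ < t → 1ℚ ≤ ℕ→ℚ p * (t * t * t)
    → x ≤ (ℕ→ℚ 3 + A * t) * F* + (ℕ→ℚ 5 + A * t) * C*)
-- By `constant-factor` the error `3 (F + F* + SC + SC*)` is at most `3 * 27 = 81` times `F* + SC*`;
-- division by `m` and `1/m ≤ 2 t` double this to 162.
theorem3p1 = ℕ→ℚ 162 , λ I p 1≤p S ∣S∣ optimal x cost-S s F* C* opt t 0<t 1≤pt³ →
  bound I p 1≤p S ∣S∣ optimal x cost-S s F* C* opt t 0<t 1≤pt³ (root p 1≤p)
  where
  bound : ∀ I p → 1 ℕ.≤ p → (S : Subset (Instance.n I)) → ∣ S ∣ ≡ Instance.k I → Cost.LocallyOptimal I p S →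
    ∀ x → IsCostOfSet I S x → ∀ s F* C* → IsOptimal I s F* C* → ∀ t → 0ℚ < t → 1ℚ ≤ ℕ→ℚ p * (t * t * t) →
    (∃ λ m → 0 ℕ.< m × m ℕ.* m ℕ.≤ p × p ℕ.≤ (m ℕ.+ m) ℕ.* (m ℕ.+ m) ℕ.* (m ℕ.+ m)) →
    x ≤ (ℕ→ℚ 3 + ℕ→ℚ 162 * t) * F* + (ℕ→ℚ 5 + ℕ→ℚ 162 * t) * C*
  bound I p 1≤p S ∣S∣ optimal x cost-S@((σ , matching , α , assign-σ , x≡) , _) s F* C* (F*≡ , assign-s , _) t 0<t
      1≤pt³ (m , 0<m , m²≤p , p≤) =
    conclude (Cost.assignCost-elim I assign-σ) (Cost.assignCost-elim I assign-s)
    where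
    open Instance I
    open Cost I
    M : ℚ
    M = ℕ→ℚ m
    0<M : 0ℚ < M
    0<M = ℚ.<-≤-trans (ℚ.positive⁻¹ 1ℚ) (ℕ→ℚ-mono-≤ 0<m)
    -- `u` is `2 m t`; its cube is at least `p * t³ ≥ 1`, and so `1/m ≤ 2 t`.
    u : ℚ
    u = (M + M) * t
    0≤t : 0ℚ ≤ t
    0≤t = ℚ.<⇒≤ 0<t
    1≤u : 1ℚ ≤ u
    1≤u = 1≤u³⇒1≤u (*≥0 (+≥0 (ℕ→ℚ-nonneg m) (ℕ→ℚ-nonneg m)) 0≤t)
      (≤-trans 1≤pt³ (≤-trans (≤-reflexive (ℚ.*-comm (ℕ→ℚ p) (t * t * t)))
        (≤-trans (*-mono-≤ˡ (*≥0 (*≥0 0≤t 0≤t) 0≤t) (ℕ→ℚ-mono-≤ p≤))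
          (≤-reflexive (trans (cong (t * t * t *_) (trans (ℕ→ℚ-* ((m ℕ.+ m) ℕ.* (m ℕ.+ m)) (m ℕ.+ m))
              (trans (cong (_* ℕ→ℚ (m ℕ.+ m)) (ℕ→ℚ-* (m ℕ.+ m) (m ℕ.+ m))) (cong (λ z → z * z * z) (ℕ→ℚ-+ m m)))))
            (solve 2 (λ r t → t :* t :* t :* (r :* r :* r) := r :* t :* (r :* t) :* (r :* t)) refl (M + M) t))))))
    conclude : (∃ λ b → Nearest σ b × α ≡ serviceCost σ b) → (∃ λ a → Nearest s a × C* ≡ serviceCost s a) →
      x ≤ (ℕ→ℚ 3 + ℕ→ℚ 162 * t) * F* + (ℕ→ℚ 5 + ℕ→ℚ 162 * t) * C*
    conclude (b , near-b , α≡) (a , _ , C*≡) = subst₂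
        (λ y z → x ≤ (ℕ→ℚ 3 + ℕ→ℚ 162 * t) * y + (ℕ→ℚ 5 + ℕ→ℚ 162 * t) * z) (sym F*≡) (sym C*≡)
      (≤-trans (≤-reflexive x≡′) (*-cancel-≤ {M} 0<M (≤-by-diff _
        (+≥0 (diff≥0 (B.averaged 0<m m²≤p)) (+≥0 (*≥0 (ℕ→ℚ-nonneg 3) (diff≥0 (B.constant-factor 1≤p)))
            (*≥0 (*≥0 (ℕ→ℚ-nonneg 81) (diff≥0 1≤u)) total≥0)))
        (solve 6 (λ M t F F* SC SC* →
          M :* ((con (ℕ→ℚ 3) :+ con (ℕ→ℚ 162) :* t) :* F* :+ (con (ℕ→ℚ 5) :+ con (ℕ→ℚ 162) :* t) :* SC*) :=
          M :* (F :+ SC) :+ (M :* (con (ℕ→ℚ 3) :* F* :+ con (ℕ→ℚ 5) :* SC*) :+ con (ℕ→ℚ 3) :*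
              (F :+ F* :+ (SC :+ SC*)) :- M :* (F :+ SC)
           :+ (con (ℕ→ℚ 3) :* (con (ℕ→ℚ 26) :* (F* :+ SC*) :- (F :+ SC)) :+ con (ℕ→ℚ 81) :* ((M :+ M) :* t :- con 1ℚ)
               :* (F* :+ SC*)))) refl
          M t B.F B.F* B.SC B.SC*))))
      where
      x≡′ : x ≡ moveCost I σ + serviceCost σ b
      x≡′ = trans x≡ (cong (moveCost I σ +_) α≡)
      module B = Analysis I b s a ∣S∣ optimal cost-S matching x≡′ near-b
      total≥0 : 0ℚ ≤ B.F* + B.SC*
      total≥0 = +≥0 (∑-nonneg λ i → c-nonneg (loc i) (s i))
          (∑-nonneg λ j → *≥0 (weight-nonneg j) (c-nonneg j (s (a j))))
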